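{- Let $q>3$ be a prime power, let $t>1$ be an integer, and let $f(x),f'(x)\in\mathbb F_{q^t}[x]$ be scattered $\mathbb F_q$-linearized polynomials. A bijection $\alpha:\mathbb F_{q^t}^2\to\mathbb F_{q^t}^2$ is an isomorphism between the translation planes $\mathcal A_f$ and $\mathcal A_{f'}$ if and only if there exist a vector $u\in\mathbb F_{q^t}^2$, an element $h'\in\mathbb F_{q^t}^*$ and a bijective $\mathbb F_{q^t}$-semilinear map $\lambda:\mathbb F_{q^t}^2\to\mathbb F_{q^t}^2$ such that $\lambda(U_f)=h'U_{f'}$ and $\alpha(v)=\lambda(v)+u$ for all $v\in\mathbb F_{q^t}^2$. Therefore, the planes $\mathcal A_f$ and $\mathcal A_{f'}$ are isomorphic if and only if $U_f$ and $U_{f'}$ belong to the same orbit under the action of $\Gamma\mathrm L(2,q^t)$ (the group of all bijective $\mathbb F_{q^t}$-semilinear maps of $\mathbb F_{q^t}^2$, acting on $\mathbb F_q$-subspaces of $\mathbb F_{q^t}^2$).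
   Context: An $\mathbb F_q$-linearized polynomial in $\mathbb F_{q^t}[x]$ is one of the form $f(x)=\sum_{i=0}^k a_ix^{q^i}$. It is called scattered if for all $y,z\in\mathbb F_{q^t}$ the condition $zf(y)-yf(z)=0$ implies that $y$ and $z$ are linearly dependent over $\mathbb F_q$. For a scattered $\mathbb F_q$-linearized polynomial $f(x)$ put $U_f=\{(x,f(x)) : x\in\mathbb F_{q^t}\}$, an $\mathbb F_q$-subspace of $\mathbb F_{q^t}^2$, and $L_f=\{f(x)/x : x\in\mathbb F_{q^t}^*\}\subseteq\mathbb F_{q^t}$. For $h\in\mathbb F_{q^t}^*$, $hU_f=\{hv: v\in U_f\}$. A planar spread of a vector space $\mathbb V$ is a collection $\mathcal B$ of at least three subspaces such that $\mathbb V=V\oplus V'$ for all distinct $V,V'\in\mathcal B$ and every vector of $\mathbb V$ lies in some member of $\mathcal B$. The translation plane $\mathcal A(\mathcal B)$ is the affine plane whose points are the vectors of $\mathbb V$ and whose lines are the cosets $V+w$ ($V\in\mathcal B$, $w\in\mathbb V$). Let $\mathcal B_f$ be the collection consisting of the following subspaces of $\mathbb F_{q^t}^2$: $\langle(1,m)\rangle_{\mathbb F_{q^t}}$ for $m\in\mathbb F_{q^t}\setminus L_f$; $hU_f$ for $h\in\mathbb F_{q^t}^*$; and $\{0\}\times\mathbb F_{q^t}$. This is a planar spread of $\mathbb F_{q^t}^2$ (as an $\mathbb F_q$-vector space), and the translation plane associated with $f$ is $\mathcal A_f=\mathcal A(\mathcal B_f)$. An isomorphism of planes is a bijection between the point sets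 that maps lines onto lines (in both directions). -}

module Defs where

open import Algebra.Apartness.Structures using (IsHeytingField)
open import Algebra.Bundles using (RawRing)
open import Algebra.Core using (Op₁; Op₂)
import Algebra.Definitions.RawSemiring as RawSemiringDefinitions
open import Algebra.Morphism.Structures using (module RingMorphisms)
open import Data.Fin.Base using (Fin; toℕ)
open import Data.Nat.Base as ℕ using (ℕ)
open import Data.Nat.Primality using (Prime)
open import Data.Product.Base using (_×_; _,_; ∃-syntax; Σ-syntax; proj₁; proj₂)
open import Data.Sum.Base using (_⊎_)
open import Data.Vec.Functional using (Vector)
open import Function.Base using (_∘_)
open import Function.Bundles using (_↔_; _⤖_; module Bijection)
open import Function.Definitions using (Bijective)
open import Level using (Level; _⊔_; suc)
open import Relation.Binary.PropositionalEquality.Core using (_≡_; _≢_)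
open import Relation.Nullary.Negation.Core using (¬_)
open import Relation.Unary using (Pred; _∈_; _∉_; _≐_; _⊢_)

IsPrimePower : ℕ → Set
IsPrimePower q = ∃[ p ] ∃[ k ] Prime p × q ≡ p ℕ.^ ℕ.suc k

-- A field with n elements. On a finite set equality is decidable, so the
-- library's notion of field, taken with inequality as its apartness relation,
-- is the classical one.
record FiniteField (c : Level) (n : ℕ) : Set (suc c) where
  infix  8 -_
  infixl 7 _*_
  infixl 6 _+_ _-_
  field
    Carrier        : Set c
    _+_ _*_        : Op₂ Carrier
    -_             : Op₁ Carrier
    0# 1#          : Carrier
    isHeytingField : IsHeytingField _≡_ _≢_ _+_ _*_ -_ 0# 1#
    cardinality    : Carrier ↔ Fin n

  open IsHeytingField isHeytingField public using (#⇒invertible)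

  rawRing : RawRing c c
  rawRing = record
    { Carrier = Carrier ; _≈_ = _≡_ ; _+_ = _+_ ; _*_ = _*_
    ; -_ = -_ ; 0# = 0# ; 1# = 1# }

  open RawSemiringDefinitions (RawRing.rawSemiring rawRing) public
    using (_^_; sum)

  _-_ : Op₂ Carrier
  x - y = x + (- y)

  -- The library inverts differences of apart elements: this is the inverse
  -- of x - 0.
  inverse : (x : Carrier) → x ≢ 0# → Carrier
  inverse x x≢0 = proj₁ (#⇒invertible x≢0)

  quotient : Carrier → (x : Carrier) → x ≢ 0# → Carrier
  quotient y x x≢0 = y * inverse x x≢0

image : ∀ {a b ℓ} {A : Set a} {B : Set b} →
        (A → B) → Pred A ℓ → Pred B (a ⊔ b ⊔ ℓ)
image f P y = ∃[ x ] x ∈ P × y ≡ f x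

-- Lines are sets of points, and sets of points are predicates considered up
-- to _≐_.
record Plane (p : Level) : Set (suc (suc p)) where
  field
    Point : Set p
    Line  : Pred (Pred Point p) (suc p)

open Plane public

-- The preimage of l′ under the bijection α is its image under the inverse
-- of α.
IsPlaneIsomorphism : ∀ {p} (Π Π′ : Plane p) → Point Π ⤖ Point Π′ → Set (suc p)
IsPlaneIsomorphism Π Π′ α =
    (∀ l  → l  ∈ Line Π  → image to l ∈ Line Π′)
  × (∀ l′ → l′ ∈ Line Π′ → (to ⊢ l′) ∈ Line Π)
  where open Bijection α using (to)

Isomorphic : ∀ {p} → Plane p → Plane p → Set (suc p)
Isomorphic Π Π′ = Σ[ α ∈ Point Π ⤖ Point Π′ ] IsPlaneIsomorphism Π Π′ α

IsSubfieldEmbedding : ∀ {a b m n} (F : FiniteField a m) (K : FiniteField b n) →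
                      (FiniteField.Carrier F → FiniteField.Carrier K) → Set (a ⊔ b)
IsSubfieldEmbedding F K =
  RingMorphisms.IsRingMonomorphism (FiniteField.rawRing F) (FiniteField.rawRing K)

-- F plays the role of 𝔽_q inside K through the embedding ι.
module ScatteredPolynomials
  {a b : Level} {q n : ℕ} (F : FiniteField a q) (K : FiniteField b n)
  (ι : FiniteField.Carrier F → FiniteField.Carrier K)
  where

  open FiniteField K
  open FiniteField F using () renaming (Carrier to 𝔽; 0# to 0F)

  record LinearizedPolynomial : Set b where
    field
      k           : ℕ
      coefficient : Vector Carrier (ℕ.suc k)

    -- ⟦_⟧ x = Σ_{i=0}^{k} aᵢ x^(q^i)
    ⟦_⟧ : Carrier → Carrier
    ⟦_⟧ x = sum (λ i → coefficient i * x ^ (q ℕ.^ toℕ i))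

  open LinearizedPolynomial public using (⟦_⟧)

  LinearlyDependent : Carrier → Carrier → Set (a ⊔ b)
  LinearlyDependent y z =
    ∃[ c ] ∃[ d ] ¬ (c ≡ 0F × d ≡ 0F) × ι c * y + ι d * z ≡ 0#

  IsScattered : LinearizedPolynomial → Set (a ⊔ b)
  IsScattered f = ∀ y z → z * ⟦ f ⟧ y - y * ⟦ f ⟧ z ≡ 0# → LinearlyDependent y z

  V : Set b
  V = Carrier × Carrier

  Subset : Set (suc b)
  Subset = Pred V b

  infixl 6 _+ᵥ_
  _+ᵥ_ : V → V → V
  (x , y) +ᵥ (x′ , y′) = (x + x′ , y + y′)

  infixr 7 _·ᵥ_
  _·ᵥ_ : Carrier → V → V
  c ·ᵥ (x , y) = (c * x , c * y)

  U : LinearizedPolynomial → Subset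
  U f v = ∃[ x ] v ≡ (x , ⟦ f ⟧ x)

  L : LinearizedPolynomial → Pred Carrier b
  L f m = ∃[ x ] Σ[ x≢0 ∈ x ≢ 0# ] m ≡ quotient (⟦ f ⟧ x) x x≢0

  scale : Carrier → Subset → Subset
  scale h = image (h ·ᵥ_)

  span : V → Subset
  span v w = ∃[ c ] w ≡ c ·ᵥ v

  verticalAxis : Subset
  verticalAxis (x , y) = x ≡ 0#

  translate : Subset → V → Subset
  translate W w = image (_+ᵥ w) W

  translationPlane : Pred Subset b → Plane b
  translationPlane 𝓑 = record
    { Point = V
    ; Line  = λ l → ∃[ W ] W ∈ 𝓑 × (∃[ w ] l ≐ translate W w)
    }

  𝓑 : LinearizedPolynomial → Pred Subset b
  𝓑 f W = (∃[ m ] m ∉ L f × W ≐ span (1# , m))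
        ⊎ (∃[ h ] h ≢ 0# × W ≐ scale h (U f))
        ⊎ W ≐ verticalAxis

  𝓐 : LinearizedPolynomial → Plane b
  𝓐 f = translationPlane (𝓑 f)

  IsAutomorphism : (Carrier → Carrier) → Set b
  IsAutomorphism = RingMorphisms.IsRingIsomorphism rawRing rawRing

  IsSemilinear : (V → V) → Set b
  IsSemilinear φ =
      (∀ v w → φ (v +ᵥ w) ≡ φ v +ᵥ φ w)
    × (∃[ σ ] IsAutomorphism σ × (∀ c v → φ (c ·ᵥ v) ≡ σ c ·ᵥ φ v))

  IsΓL : (V → V) → Set b
  IsΓL φ = Bijective _≡_ _≡_ φ × IsSemilinear φ

  SameΓLOrbit : Subset → Subset → Set b
  SameΓLOrbit W W′ = ∃[ φ ] IsΓL φ × image φ W ≐ W′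

-- An isomorphism α with α(0) = 0 maps components to components, so it is
-- additive (André). The components of 𝓑_f that are 𝔽_{q^t}-lines and go to
-- 𝔽_{q^t}-lines are many: since f is 𝔽_q-linear, each line missing from 𝓑_f
-- accounts for at least q − 1 ≥ 3 nonzero x (those with f(x) = m x), and each
-- line sent to some h U_{f′} for at least 3 scalars h; hence at most two thirds of
-- the slopes are lost. Choose coordinates on both sides in which three of the surviving
-- lines are y = 0, x = 0 and y = x. There α is (x , y) ↦ (g x , g y) with g(1) = 1, and
-- y = μ x survives exactly when g(μ x) = g(μ) g(x) for all x. These μ form a
-- subfield S; a proper subfield satisfies |S|² ≤ q^t, which contradicts the
-- count. So S is everything, g is an automorphism and α is semilinear. It cannot
-- send U_f to a line, hence sends it to some h′ U_{f′}.
module Submission where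

open import Defs
open import Algebra.Apartness.Structures using (IsHeytingField)
open import Algebra.Bundles using (CommutativeRing)
import Algebra.Properties.CommutativeMonoid.Sum as CommutativeMonoidSum
open import Algebra.Core using (Op₁; Op₂)
import Algebra.Properties.CommutativeSemiring.Binomial as Binomial
import Algebra.Properties.Ring as RingProperties
import Algebra.Properties.Semiring.Exp as Exp
import Algebra.Properties.CommutativeSemiring.Exp as CommutativeExp
import Algebra.Properties.Semiring.Mult as Mult
import Algebra.Properties.Semiring.Mult.TCOptimised as MultTCOptimised
import Algebra.Properties.Semiring.Sum as SemiringSum
import Algebra.Solver.Ring as RingSolver
open import Algebra.Morphism.Structures using (module RingMorphisms)
open import Algebra.Solver.Ring.AlmostCommutativeRing using (_-Raw-AlmostCommutative⟶_; fromCommutativeRing)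
open import Algebra.Structures using (IsCommutativeRing)
open import Data.Fin.Base as Fin using (Fin; zero; suc; punchIn; inject≤; toℕ; fromℕ; inject₁)
open import Data.Fin.Permutation using (Permutation)
open import Data.Fin.Properties as Fin using (any?; all?; injective⇒≤; suc-injective; +↔⊎; *↔×)
open import Data.Integer.Base as ℤ using (ℤ; -[1+_]; _⊖_; _◃_)
import Data.Integer.Properties as ℤ
import Data.Maybe.Base as Maybe
open import Data.Nat.Base as ℕ using (ℕ)
open import Data.Nat.Combinatorics using (_C_; nCn≡1; nCk+nC[k+1]≡[n+1]C[k+1])
open import Data.Nat.Divisibility using (_∣_; divides)
open import Data.Nat.Primality using (Prime; prime⇒nonTrivial)
import Data.Nat.Properties as ℕ
open import Data.Nat.Solver using (module +-*-Solver)
open import Data.Product.Base using (_×_; _,_; ∃-syntax; proj₁; proj₂)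
open import Data.Product.Properties using (≡-dec)
open import Data.Product.Function.NonDependent.Propositional using (_×-↔_)
import Data.Sign.Base as Sign
open import Data.Sum.Base using (_⊎_; inj₁; inj₂; [_,_]′)
open import Data.Sum.Properties using (inj₁-injective; inj₂-injective)
open import Data.Sum.Function.Propositional using (_⊎-↔_)
open import Function.Base using (_∘_; id; case_of_)
open import Function.Bundles using (_⇔_; _↔_; _⤖_; Inverse; Bijection; mk⇔; mk⤖; mk↔ₛ′)
open import Function.Construct.Composition using (_↔-∘_)
open import Function.Construct.Symmetry using (↔-sym)
open import Function.Definitions using (Injective; Surjective)
open import Function.Properties.Inverse using (↔⇒↣)
open import Level using (_⊔_)
open import Relation.Binary.Definitions using (DecidableEquality)
open import Relation.Binary.PropositionalEquality using (_≡_; _≢_; refl; sym; trans; cong; cong₂; subst; module ≡-Reasoning)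
open import Relation.Binary.PropositionalEquality.Algebra using (isMagma)
open import Relation.Nullary.Decidable using (Dec; yes; no; map′; via-injection; decidable-stable; ¬?; dec⇒maybe; _×-dec_)
open import Relation.Nullary.Negation using (¬_; contradiction)
open import Relation.Unary using (Pred; Decidable; ∁; _∈_; _∉_; _≐_; _⊢_)
open import Relation.Unary.Properties using (≐-refl; ≐-sym; ≐-trans)

-- The obstacle is that `𝓑 f` mixes 𝔽_{q^t}-lines with the sets `scale h (U f)`, which are only
-- 𝔽_q-subspaces, and an isomorphism might interchange the two kinds. No single line can be assumed
-- to go to a line, so one has to count. The constants come from this count. Write n = q^t. The
-- elements charged to lost slopes lie in two copies of the field, so charging r elements to each
-- slope leaves at most 2n/r lost slopes: r = 2 says nothing, while r = 3, available because q > 3,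
-- leaves k ≥ n/3 survivors. One survivor becomes the axis at infinity of the new coordinates, so
-- only k - 1 of them yield elements of the subfield; n ≤ 3k < (k - 1)² holds for k ≥ 6, which n ≥
-- 4² guarantees. For the converse, a semilinear map carries lines that miss `U f` to lines that
-- miss its image, and multiples of `U f` to multiples of that image. The orbit criterion follows by
-- dividing the map by h′. A finite field is given by its cardinality alone, so the additivity of f
-- rests on a derivation of the characteristic and of the Frobenius identities.

record Enumeration {a p} {A : Set a} (P : Pred A p) (k : ℕ) : Set (a ⊔ p) where
  field
    element   : Fin k → A
    injective : Injective _≡_ _≡_ element
    satisfies : ∀ i → P (element i)

-- Counting in finite sets

private module _ where
  open Enumeration

  extend : ∀ {n k p} {P : Pred (Fin (ℕ.suc n)) p} → P zero →
           Enumeration (P ∘ suc) k → Enumeration P (ℕ.suc k)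
  extend p₀ e .element zero    = zero
  extend p₀ e .element (suc i) = suc (e .element i)
  extend p₀ e .injective {zero}  {zero}  _  = refl
  extend p₀ e .injective {suc i} {suc j} eq = cong suc (e .injective (suc-injective eq))
  extend p₀ e .satisfies zero    = p₀
  extend p₀ e .satisfies (suc i) = e .satisfies i

  shift : ∀ {n k p} {P : Pred (Fin (ℕ.suc n)) p} →
          Enumeration (P ∘ suc) k → Enumeration P k
  shift e .element   = suc ∘ e .element
  shift e .injective = e .injective ∘ suc-injective
  shift e .satisfies = e .satisfies

  partitionFin : ∀ {n p} {P : Pred (Fin n) p} → Decidable P →
                 ∃[ k ] ∃[ l ] k ℕ.+ l ≡ n × Enumeration P k × Enumeration (∁ P) l
  partitionFin {ℕ.zero} P? = 0 , 0 , refl , empty , empty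
    where
    empty : ∀ {q} {Q : Pred (Fin 0) q} → Enumeration Q 0
    empty = record { element = λ () ; injective = λ {} ; satisfies = λ () }
  partitionFin {ℕ.suc n} P? with partitionFin (P? ∘ suc) | P? zero
  ... | k , l , eq , e , e′ | yes p₀ =
    ℕ.suc k , l , cong ℕ.suc eq , extend p₀ e , shift e′
  ... | k , l , eq , e , e′ | no ¬p₀ =
    k , ℕ.suc l , trans (ℕ.+-suc k l) (cong ℕ.suc eq) , shift e , extend ¬p₀ e′

module _ {a n} {A : Set a} (A↔Fin : A ↔ Fin n) where
  open Inverse A↔Fin

  private
    to-injective : Injective _≡_ _≡_ to
    to-injective eq = trans (sym (strictlyInverseʳ _)) (trans (cong from eq) (strictlyInverseʳ _))

    from-injective : Injective _≡_ _≡_ from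
    from-injective eq = trans (sym (strictlyInverseˡ _)) (trans (cong to eq) (strictlyInverseˡ _))

  ∃? : ∀ {p} {P : Pred A p} → Decidable P → Dec (∃[ x ] P x)
  ∃? {P = P} P? = map′
    (λ (i , p) → from i , p)
    (λ (x , p) → to x , subst P (sym (strictlyInverseʳ x)) p)
    (any? (P? ∘ from))

  ∀? : ∀ {p} {P : Pred A p} → Decidable P → Dec (∀ x → P x)
  ∀? {P = P} P? = map′
    (λ p x → subst P (strictlyInverseʳ x) (p (to x)))
    (λ p i → p (from i))
    (all? (P? ∘ from))

  -- An `Enumeration` by itself only bounds the number of solutions from below; here the sizes add
  -- up to `n`, so both are exact.
  partition : ∀ {p} {P : Pred A p} → Decidable P →
              ∃[ k ] ∃[ l ] k ℕ.+ l ≡ n × Enumeration P k × Enumeration (∁ P) l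
  partition P? with partitionFin (P? ∘ from)
  ... | k , l , eq , e , e′ = k , l , eq , transport e , transport e′
    where
    transport : ∀ {k q} {Q : Pred A q} → Enumeration (Q ∘ from) k → Enumeration Q k
    transport e = record
      { element   = from ∘ element
      ; injective = injective ∘ from-injective
      ; satisfies = satisfies
      }
      where open Enumeration e

  injection-≤ : ∀ {b m} {B : Set b} → B ↔ Fin m →
                {f : B → A} → Injective _≡_ _≡_ f → m ℕ.≤ n
  injection-≤ B↔Fin {f} inj = injective⇒≤ {f = to ∘ f ∘ B.from} λ eq →
    trans (sym (B.strictlyInverseˡ _))
      (trans (cong B.to (inj (to-injective eq))) (B.strictlyInverseˡ _))
    where module B = Inverse B↔Fin

  -- Pigeonhole: a missed value `y`, adjoined to the values of `f`, would inject n + 1 elements into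
  -- n.
  injective⇒surjective : {f : A → A} → Injective _≡_ _≡_ f → ∀ y → ∃[ x ] f x ≡ y
  injective⇒surjective {f} inj y with any? (λ i → to (f (from i)) Fin.≟ to y)
  ... | yes (i , eq) = from i , to-injective eq
  ... | no  ∄i       = contradiction (injective⇒≤ g-injective) ℕ.1+n≰n
    where
    g : Fin (ℕ.suc n) → Fin n
    g zero    = to y
    g (suc i) = to (f (from i))

    g-injective : Injective _≡_ _≡_ g
    g-injective {zero}  {zero}  _  = refl
    g-injective {zero}  {suc j} eq = contradiction (j , sym eq) ∄i
    g-injective {suc i} {zero}  eq = contradiction (i , eq) ∄i
    g-injective {suc i} {suc j} eq = cong suc (from-injective (inj (to-injective eq)))

-- Solving ring identities with integer coefficients

module IntegerCoefficients
  {a} {A : Set a} {add mul : Op₂ A} {neg : Op₁ A} {zero# one# : A}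
  (isCommutativeRing : IsCommutativeRing _≡_ add mul neg zero# one#)
  where
  private
    commutativeRing : CommutativeRing a a
    commutativeRing = record { isCommutativeRing = isCommutativeRing }

  open CommutativeRing commutativeRing hiding (_≈_; refl; sym; trans; zero)
  open RingProperties ring
  open MultTCOptimised semiring using (×1-homo-*; ×-homo-+) renaming (_×_ to _·_)
  open ≡-Reasoning
  -- These multiples are defined so that `1 · 1#` reduces to `1#`; this is why `0-homo` and `1-homo`
  -- below hold by `refl`.
  ⟦_⟧ᶻ : ℤ → A
  ⟦ ℤ.+ n      ⟧ᶻ = n · 1#
  ⟦ -[1+ n ] ⟧ᶻ = - (ℕ.suc n · 1#)

  private
    suc-· : ∀ n → ℕ.suc n · 1# ≡ 1# + n · 1#
    suc-· n = ×-homo-+ 1# 1 n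

    cancel : ∀ x y z → (x + y) - (x + z) ≡ y - z
    cancel x y z = begin
      (x + y) + - (x + z)      ≡⟨ cong₂ _+_ (+-comm x y) (sym (-‿+-comm x z)) ⟩
      (y + x) + (- x + - z)    ≡⟨ +-assoc y x _ ⟩
      y + (x + (- x + - z))    ≡⟨ cong (y +_) (sym (+-assoc x (- x) (- z))) ⟩
      y + ((x + - x) + - z)    ≡⟨ cong (λ u → y + (u - z)) (-‿inverseʳ x) ⟩
      y + (0# + - z)           ≡⟨ cong (y +_) (+-identityˡ _) ⟩
      y - z                    ∎

    ⊖-homo : ∀ m n → ⟦ m ⊖ n ⟧ᶻ ≡ m · 1# - n · 1#
    ⊖-homo m         ℕ.zero    = sym (trans (cong (m · 1# +_) -0#≈0#) (+-identityʳ _))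
    ⊖-homo ℕ.zero    (ℕ.suc n) = sym (+-identityˡ _)
    ⊖-homo (ℕ.suc m) (ℕ.suc n) = begin
      ⟦ ℕ.suc m ⊖ ℕ.suc n ⟧ᶻ           ≡⟨ cong ⟦_⟧ᶻ (ℤ.[1+m]⊖[1+n]≡m⊖n m n) ⟩
      ⟦ m ⊖ n ⟧ᶻ                       ≡⟨ ⊖-homo m n ⟩
      m · 1# - n · 1#                  ≡⟨ cancel 1# _ _ ⟨
      (1# + m · 1#) - (1# + n · 1#)    ≡⟨ cong₂ _-_ (suc-· m) (suc-· n) ⟨
      ℕ.suc m · 1# - ℕ.suc n · 1#      ∎

    neg-homo : ∀ i → ⟦ ℤ.- i ⟧ᶻ ≡ - ⟦ i ⟧ᶻ
    neg-homo (ℤ.+ ℕ.zero)  = sym -0#≈0#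
    neg-homo (ℤ.+ ℕ.suc n) = refl
    neg-homo -[1+ n ]    = sym (-‿involutive _)

    +-homo : ∀ i j → ⟦ i ℤ.+ j ⟧ᶻ ≡ ⟦ i ⟧ᶻ + ⟦ j ⟧ᶻ
    +-homo (ℤ.+ m)    (ℤ.+ n)    = ×-homo-+ 1# m n
    +-homo (ℤ.+ m)    -[1+ n ] = ⊖-homo m (ℕ.suc n)
    +-homo -[1+ m ] (ℤ.+ n)    = trans (⊖-homo n (ℕ.suc m)) (+-comm _ _)
    +-homo -[1+ m ] -[1+ n ] = begin
      - (ℕ.suc (ℕ.suc (m ℕ.+ n)) · 1#)        ≡⟨ cong (λ k → - (k · 1#)) (ℕ.+-suc (ℕ.suc m) n) ⟨
      - ((ℕ.suc m ℕ.+ ℕ.suc n) · 1#)          ≡⟨ cong -_ (×-homo-+ 1# (ℕ.suc m) (ℕ.suc n)) ⟩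
      - (ℕ.suc m · 1# + ℕ.suc n · 1#)         ≡⟨ -‿+-comm _ _ ⟨
      - (ℕ.suc m · 1#) + - (ℕ.suc n · 1#)     ∎

    *-homo⁺ : ∀ m n → (m ℕ.* n) · 1# ≡ (m · 1#) * (n · 1#)
    *-homo⁺ = ×1-homo-*

    negative-◃ : ∀ n → ⟦ Sign.- ◃ n ⟧ᶻ ≡ - (n · 1#)
    negative-◃ ℕ.zero    = sym -0#≈0#
    negative-◃ (ℕ.suc n) = refl

    *-homo : ∀ i j → ⟦ i ℤ.* j ⟧ᶻ ≡ ⟦ i ⟧ᶻ * ⟦ j ⟧ᶻ
    *-homo (ℤ.+ m) (ℤ.+ n) = begin
      ⟦ Sign.+ ◃ m ℕ.* n ⟧ᶻ   ≡⟨ cong ⟦_⟧ᶻ (ℤ.+◃n≡+n (m ℕ.* n)) ⟩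
      (m ℕ.* n) · 1#          ≡⟨ *-homo⁺ m n ⟩
      (m · 1#) * (n · 1#)     ∎
    *-homo (ℤ.+ m) -[1+ n ] = begin
      ⟦ Sign.- ◃ m ℕ.* ℕ.suc n ⟧ᶻ        ≡⟨ negative-◃ (m ℕ.* ℕ.suc n) ⟩
      - ((m ℕ.* ℕ.suc n) · 1#)           ≡⟨ cong -_ (*-homo⁺ m (ℕ.suc n)) ⟩
      - ((m · 1#) * (ℕ.suc n · 1#))      ≡⟨ -‿distribʳ-* _ _ ⟩
      (m · 1#) * - (ℕ.suc n · 1#)        ∎
    *-homo -[1+ m ] (ℤ.+ n) = begin
      ⟦ Sign.- ◃ ℕ.suc m ℕ.* n ⟧ᶻ        ≡⟨ negative-◃ (ℕ.suc m ℕ.* n) ⟩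
      - ((ℕ.suc m ℕ.* n) · 1#)           ≡⟨ cong -_ (*-homo⁺ (ℕ.suc m) n) ⟩
      - ((ℕ.suc m · 1#) * (n · 1#))      ≡⟨ -‿distribˡ-* _ _ ⟩
      - (ℕ.suc m · 1#) * (n · 1#)        ∎
    *-homo -[1+ m ] -[1+ n ] = begin
      (ℕ.suc m ℕ.* ℕ.suc n) · 1#                 ≡⟨ *-homo⁺ (ℕ.suc m) (ℕ.suc n) ⟩
      (ℕ.suc m · 1#) * (ℕ.suc n · 1#)            ≡⟨ -‿involutive _ ⟨
      - - ((ℕ.suc m · 1#) * (ℕ.suc n · 1#))      ≡⟨ cong -_ (-‿distribʳ-* _ _) ⟩
      - ((ℕ.suc m · 1#) * - (ℕ.suc n · 1#))      ≡⟨ -‿distribˡ-* _ _ ⟩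
      - (ℕ.suc m · 1#) * - (ℕ.suc n · 1#)        ∎

  -- The solver normalises over ℤ, where coefficients can be compared, and transports the result
  -- along this homomorphism; an identity valid over ℤ is thus available in every characteristic.
  morphism : ℤ.+-*-rawRing -Raw-AlmostCommutative⟶ fromCommutativeRing commutativeRing
  morphism = record
    { ⟦_⟧    = ⟦_⟧ᶻ
    ; +-homo = +-homo
    ; *-homo = *-homo
    ; -‿homo = neg-homo
    ; 0-homo = refl
    ; 1-homo = refl
    }

  open RingSolver ℤ.+-*-rawRing (fromCommutativeRing commutativeRing) morphism
    (λ i j → Maybe.map (cong ⟦_⟧ᶻ) (dec⇒maybe (i ℤ.≟ j))) public
    using (Polynomial; solve; _:+_; _:*_; _:-_; :-_; _:=_; con)



-- Arithmetic in a finite field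

module Field {c n} (K : FiniteField c n) where
  open FiniteField K hiding (_^_; sum)

  commutativeRing : CommutativeRing c c
  commutativeRing = record
    { isCommutativeRing = IsHeytingField.isCommutativeRing isHeytingField }

  open CommutativeRing commutativeRing public
    hiding (Carrier; _≈_; _+_; _*_; -_; 0#; 1#; _-_; refl; sym; trans; zero; rawRing)
  open RingProperties ring public
  open IntegerCoefficients isCommutativeRing public
    using (Polynomial; solve; _:+_; _:*_; _:-_; :-_; _:=_; con)
  open ≡-Reasoning

  infix 4 _≟_
  _≟_ : DecidableEquality Carrier
  _≟_ = via-injection (↔⇒↣ cardinality) Fin._≟_

  -- The field axioms make two elements apart when their difference is invertible, and 1 is an
  -- inverse of 1 - 0.
  1≢0 : 1# ≢ 0#
  1≢0 = IsHeytingField.invertible⇒# isHeytingField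
    ( 1#
    , trans (solve 1 (λ u → u :* (u :- con (ℤ.+ 0)) := u :* u) refl 1#) (*-identityˡ 1#)
    , trans (solve 1 (λ u → (u :- con (ℤ.+ 0)) :* u := u :* u) refl 1#) (*-identityˡ 1#) )

  inverseˡ : ∀ x (x≢0 : x ≢ 0#) → inverse x x≢0 * x ≡ 1#
  inverseˡ x x≢0 = trans
    (solve 2 (λ i y → i :* y := i :* (y :- con (ℤ.+ 0))) refl (inverse x x≢0) x)
    (proj₁ (proj₂ (#⇒invertible x≢0)))

  *-cancelˡ : ∀ {x y z} → x ≢ 0# → x * y ≡ x * z → y ≡ z
  *-cancelˡ {x} {y} {z} x≢0 eq = begin
    y            ≡⟨ lemma y ⟨
    i * (x * y)  ≡⟨ cong (i *_) eq ⟩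
    i * (x * z)  ≡⟨ lemma z ⟩
    z            ∎
    where
    i = inverse x x≢0
    lemma : ∀ w → i * (x * w) ≡ w
    lemma w = trans (sym (*-assoc i x w)) (trans (cong (_* w) (inverseˡ x x≢0)) (*-identityˡ w))

  *-zero-cancelˡ : ∀ {x y} → x ≢ 0# → x * y ≡ 0# → y ≡ 0#
  *-zero-cancelˡ x≢0 eq = *-cancelˡ x≢0 (trans eq (sym (zeroʳ _)))

  *-nonzero : ∀ {x y} → x ≢ 0# → y ≢ 0# → x * y ≢ 0#
  *-nonzero x≢0 y≢0 eq = y≢0 (*-zero-cancelˡ x≢0 eq)

  divide : ∀ {x} → x ≢ 0# → ∀ y → ∃[ z ] x * z ≡ y
  divide {x} x≢0 y = inverse x x≢0 * y ,
    trans (solve 3 (λ x i y → x :* (i :* y) := (i :* x) :* y) refl x (inverse x x≢0) y)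
          (trans (cong (_* y) (inverseˡ x x≢0)) (*-identityˡ y))

  -≡0⇒≡ : ∀ {x y} → x - y ≡ 0# → x ≡ y
  -≡0⇒≡ = x∙y⁻¹≈ε⇒x≈y _ _

  ≡⇒-≡0 : ∀ {x y} → x ≡ y → x - y ≡ 0#
  ≡⇒-≡0 {x} refl = -‿inverseʳ x

-- Binomial coefficients modulo a prime

module _ where
  open import Data.Nat.Base using (suc; _+_; _*_; _<_)
  open import Data.Nat.Combinatorics using (nC1≡n; k>n⇒nCk≡0)
  open import Data.Nat.Divisibility using (∣⇒≤)
  open import Data.Nat.Primality using (euclidsLemma)
  open ≡-Reasoning

  -- Pascal's rule splits the coefficient and the induction hypothesis applies to both parts. The
  -- form without division is the one that Euclid's lemma can use.
  absorption : ∀ n k → suc k * (suc n C suc k) ≡ suc n * (n C k)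
  absorption n 0 = trans (ℕ.*-identityˡ _) (trans (nC1≡n (suc n)) (sym (ℕ.*-identityʳ _)))
  absorption 0 (suc k) = trans (cong (suc (suc k) *_) (k>n⇒nCk≡0 {1} {suc (suc k)} (ℕ.s≤s (ℕ.s≤s ℕ.z≤n)))) (ℕ.*-zeroʳ (suc (suc k)))
  absorption (suc n) (suc k) = begin
    suc (suc k) * (suc (suc n) C suc (suc k))
      ≡⟨ cong (suc (suc k) *_) (nCk+nC[k+1]≡[n+1]C[k+1] (suc n) (suc k)) ⟨
    suc (suc k) * (c + (suc n C suc (suc k)))
      ≡⟨ ℕ.*-distribˡ-+ (suc (suc k)) c _ ⟩
    c + suc k * c + suc (suc k) * (suc n C suc (suc k))
      ≡⟨ cong₂ (λ u v → c + u + v) (absorption n k) (absorption n (suc k)) ⟩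
    c + suc n * (n C k) + suc n * (n C suc k)
      ≡⟨ ℕ.+-assoc c _ _ ⟩
    c + (suc n * (n C k) + suc n * (n C suc k))
      ≡⟨ cong (c +_) (ℕ.*-distribˡ-+ (suc n) (n C k) _) ⟨
    c + suc n * ((n C k) + (n C suc k))
      ≡⟨ cong (λ u → c + suc n * u) (nCk+nC[k+1]≡[n+1]C[k+1] n k) ⟩
    suc (suc n) * c ∎
    where c = suc n C suc k

  -- By `absorption` the prime divides the product of `suc k` and the binomial coefficient, and it
  -- is too large to divide `suc k`.
  prime∣binomial : ∀ {p k} → Prime (suc p) → suc k < suc p → suc p ∣ (suc p C suc k)
  prime∣binomial {p} {k} p-prime k<p
    with euclidsLemma (suc k) (suc p C suc k) p-prime
           (divides (p C k) (trans (absorption p k) (ℕ.*-comm (suc p) (p C k))))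
  ... | inj₁ p∣k = contradiction k<p (ℕ.≤⇒≯ (∣⇒≤ p∣k))
  ... | inj₂ p∣C = p∣C

-- Characteristic and Frobenius maps of a finite field

module Frobenius {c n} (K : FiniteField c n) where
  open FiniteField K using (Carrier; _+_; _*_; _-_; 0#; 1#; _^_; sum; cardinality; inverse)
  open Field K
  open Inverse cardinality using (to; from; strictlyInverseˡ; strictlyInverseʳ)
  open Mult semiring using (×-assoc-*; ×-comm-*; ×-homo-1; ×1-homo-*; ×-assocˡ) renaming (_×_ to _·_)
  open SemiringSum semiring using (sum-cong-≗; ∑-distrib-+; sum-replicate; sum-replicate-zero; sum-init-last; sum-permute)
  open Exp semiring using (^-assocʳ)
  open ≡-Reasoning
  private
    module Π = CommutativeMonoidSum *-commutativeMonoid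

    onIndices : Carrier ↔ Carrier → Permutation n n
    onIndices σ = cardinality ↔-∘ (σ ↔-∘ ↔-sym cardinality)

  -- Translation by 1 permutes the field, so it preserves the sum of all elements.
  order·1≡0 : n · 1# ≡ 0#
  order·1≡0 = +-cancelˡ S _ _ (begin
    S + n · 1#                     ≡⟨ cong (S +_) (sum-replicate n) ⟨
    S + sum {n} (λ _ → 1#)         ≡⟨ ∑-distrib-+ from (λ _ → 1#) ⟨
    sum (λ i → from i + 1#)        ≡⟨ sum-cong-≗ (λ i → strictlyInverseʳ (from i + 1#)) ⟨
    sum (λ i → from (to (from i + 1#))) ≡⟨ sum-permute from (onIndices translation) ⟨
    S                              ≡⟨ +-identityʳ S ⟨
    S + 0#                         ∎)
    where
    S = sum from
    translation : Carrier ↔ Carrier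
    translation = mk↔ₛ′ (_+ 1#) (_- 1#)
      (solve 2 (λ u x → x :- u :+ u := x) refl 1#)
      (solve 2 (λ u x → x :+ u :- u := x) refl 1#)

  -- Multiplication by x ≠ 0 permutes the nonzero elements, so comparing their
  -- products gives x ^ (n − 1) = 1; the factors at 0 are replaced by 1.
  ^order : ∀ x → x ^ n ≡ x
  ^order x with x ≟ 0#
  ... | yes refl = 0^order cardinality
    where
    -- An exponent 0 would give 1 instead of 0; it is excluded because the field has an element.
    0^order : ∀ {m} → Carrier ↔ Fin m → 0# ^ m ≡ 0#
    0^order {ℕ.zero}  e with () ← Inverse.to e 0#
    0^order {ℕ.suc m} e = zeroˡ _
  ... | no x≢0 = begin
    x ^ n                                  ≡⟨ Π.sum-replicate n ⟨
    Π.sum {n} (λ _ → x)                    ≡⟨ Π.sum-cong-≗ (λ i → x-split (from i)) ⟩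
    Π.sum (λ i → d (from i) * e (from i))  ≡⟨ Π.∑-distrib-+ (d ∘ from) (e ∘ from) ⟩
    Π.sum (d ∘ from) * Π.sum (e ∘ from)    ≡⟨ cong₂ _*_ Πd≡1 Πe≡x ⟩
    1# * x                                 ≡⟨ *-identityˡ x ⟩
    x                                      ∎
    where
    replaceZero : Carrier → Carrier → Carrier → Carrier
    replaceZero u v y with y ≟ 0#
    ... | yes _ = u
    ... | no  _ = v

    -- The constant x is split as `d y * e y`: `d` carries the factor at nonzero y, `e` the single
    -- factor at y = 0. The two products are then 1 and x, and the exponent n - 1 never has to be
    -- written.
    d e h : Carrier → Carrier
    d   = replaceZero 1# x
    e   = replaceZero x 1#
    h y = replaceZero 1# y y

    x-split : ∀ y → x ≡ d y * e y
    x-split y with y ≟ 0#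
    ... | yes _ = sym (*-identityˡ x)
    ... | no  _ = sym (*-identityʳ x)

    h-scale : ∀ y → h (x * y) ≡ d y * h y
    h-scale y with y ≟ 0# | x * y ≟ 0#
    ... | yes _   | yes _    = sym (*-identityˡ 1#)
    ... | yes y≡0 | no  xy≢0 = contradiction (trans (cong (x *_) y≡0) (zeroʳ x)) xy≢0
    ... | no  y≢0 | yes xy≡0 = contradiction xy≡0 (*-nonzero x≢0 y≢0)
    ... | no  _   | no  _    = refl

    h-nonzero : ∀ y → h y ≢ 0#
    h-nonzero y with y ≟ 0#
    ... | yes _  = 1≢0
    ... | no y≢0 = y≢0

    Π-nonzero : ∀ {m} (f : Fin m → Carrier) → (∀ i → f i ≢ 0#) → Π.sum f ≢ 0#
    Π-nonzero {ℕ.zero}  f f≢0 = 1≢0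
    Π-nonzero {ℕ.suc m} f f≢0 = *-nonzero (f≢0 zero) (Π-nonzero (f ∘ suc) (f≢0 ∘ suc))

    scaling : Carrier ↔ Carrier
    scaling = mk↔ₛ′ (x *_) (inverse x x≢0 *_)
      (λ y → proj₂ (divide x≢0 y))
      (λ y → *-cancelˡ x≢0 (proj₂ (divide x≢0 (x * y))))

    Πd≡1 : Π.sum (d ∘ from) ≡ 1#
    Πd≡1 = *-cancelˡ (Π-nonzero (h ∘ from) (h-nonzero ∘ from)) (begin
      Π.sum (h ∘ from) * Π.sum (d ∘ from)            ≡⟨ *-comm _ _ ⟩
      Π.sum (d ∘ from) * Π.sum (h ∘ from)            ≡⟨ Π.∑-distrib-+ (d ∘ from) (h ∘ from) ⟨
      Π.sum (λ i → d (from i) * h (from i))          ≡⟨ Π.sum-cong-≗ (λ i → h-scale (from i)) ⟨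
      Π.sum (λ i → h (x * from i))                   ≡⟨ Π.sum-cong-≗ {n} (λ i → cong h (strictlyInverseʳ (x * from i))) ⟨
      Π.sum (λ i → h (from (to (x * from i))))       ≡⟨ Π.sum-permute (h ∘ from) (onIndices scaling) ⟨
      Π.sum (h ∘ from)                               ≡⟨ *-identityʳ _ ⟨
      Π.sum (h ∘ from) * 1#                          ∎)

    Π-single : ∀ {m} (f : Fin m → Carrier) i → (∀ j → j ≢ i → f j ≡ 1#) → Π.sum f ≡ f i
    Π-single {ℕ.suc m} f zero others = trans
      (cong (f zero *_) (trans (Π.sum-cong-≗ {m} (λ j → others (suc j) λ ())) (Π.sum-replicate-zero m)))
      (*-identityʳ _)
    Π-single f (suc i) others = trans
      (cong₂ _*_ (others zero λ ()) (Π-single (f ∘ suc) i (λ j j≢i → others (suc j) (j≢i ∘ suc-injective))))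
      (*-identityˡ _)

    Πe≡x : Π.sum (e ∘ from) ≡ x
    Πe≡x = trans (Π-single (e ∘ from) (to 0#) e-one) e-zero
      where
      e-one : ∀ j → j ≢ to 0# → e (from j) ≡ 1#
      e-one j j≢ with from j ≟ 0#
      ... | yes eq = contradiction (trans (sym (strictlyInverseˡ j)) (cong to eq)) j≢
      ... | no  _  = refl
      e-zero : e (from (to 0#)) ≡ x
      e-zero with from (to 0#) ≟ 0#
      ... | yes _  = refl
      ... | no neq = contradiction (strictlyInverseʳ 0#) neq

  module _ {p j : ℕ} (p-prime : Prime p) (n≡p^j : n ≡ p ℕ.^ j) where

    -- If p·1 were nonzero, so would be its j-th power, which is p^j·1 = n·1 = 0.
    characteristic : p · 1# ≡ 0#
    characteristic with p · 1# ≟ 0#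
    ... | yes eq = eq
    ... | no neq = contradiction (trans (cong (_· 1#) (sym n≡p^j)) order·1≡0) (power-nonzero j)
      where
      power-nonzero : ∀ i → (p ℕ.^ i) · 1# ≢ 0#
      power-nonzero ℕ.zero    eq = 1≢0 (trans (sym (+-identityʳ 1#)) eq)
      power-nonzero (ℕ.suc i) eq =
        *-nonzero neq (power-nonzero i) (trans (sym (×1-homo-* p (p ℕ.^ i))) eq)

    multiple≡0 : ∀ {m} z → p ∣ m → m · z ≡ 0#
    multiple≡0 z (divides r refl) = begin
      (r ℕ.* p) · z      ≡⟨ ×-assocˡ z r p ⟨
      r · (p · z)        ≡⟨ cong (λ u → r · (p · u)) (*-identityˡ z) ⟨
      r · (p · (1# * z)) ≡⟨ cong (r ·_) (×-assoc-* p 1# z) ⟨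
      r · (p · 1# * z)   ≡⟨ cong (λ u → r · (u * z)) characteristic ⟩
      r · (0# * z)       ≡⟨ ×-assoc-* r 0# z ⟨
      (r · 0#) * z       ≡⟨ cong (λ u → (r · u) * z) (zeroˡ 0#) ⟨
      (r · (0# * 0#)) * z ≡⟨ cong (_* z) (×-comm-* r 0# 0#) ⟨
      (0# * (r · 0#)) * z ≡⟨ cong (_* z) (zeroˡ _) ⟩
      0# * z             ≡⟨ zeroˡ z ⟩
      0#                 ∎

    -- In the binomial expansion every inner coefficient is divisible by p and vanishes; only the
    -- two extreme terms remain.
    frobenius-+ : ∀ x y → (x + y) ^ p ≡ x ^ p + y ^ p
    frobenius-+ x y = go p refl
      where
      -- Passing from the parameter `p` to a matched `m` exposes the successor that is needed to
      -- split off the first and the last term.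
      go : ∀ m → p ≡ m → (x + y) ^ m ≡ x ^ m + y ^ m
      go ℕ.zero    refl with () ← ℕ.nonTrivial⇒n>1 0 {{prime⇒nonTrivial p-prime}}
      go (ℕ.suc m) refl = begin
        (x + y) ^ ℕ.suc m
          ≡⟨ theorem (ℕ.suc m) x y ⟩
        term zero + sum (term ∘ suc)
          ≡⟨ cong (term zero +_) (sum-init-last (term ∘ suc)) ⟩
        term zero + (sum (λ i → term (suc (inject₁ i))) + term (suc (fromℕ m)))
          ≡⟨ cong (λ u → term zero + (u + term (suc (fromℕ m))))
               (trans (sum-cong-≗ middle) (sum-replicate-zero m)) ⟩
        term zero + (0# + term (suc (fromℕ m)))
          ≡⟨ cong₂ (λ u v → u + (0# + v)) first final ⟩
        y ^ ℕ.suc m + (0# + x ^ ℕ.suc m)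
          ≡⟨ solve 2 (λ u v → v :+ (con (ℤ.+ 0) :+ u) := u :+ v) refl (x ^ ℕ.suc m) (y ^ ℕ.suc m) ⟩
        x ^ ℕ.suc m + y ^ ℕ.suc m ∎
        where
        open Binomial commutativeSemiring using (theorem; binomialTerm)
        term : Fin (ℕ.suc (ℕ.suc m)) → Carrier
        term = binomialTerm x y (ℕ.suc m)

        middle : ∀ i → term (suc (inject₁ i)) ≡ 0#
        middle i = multiple≡0 _ (prime∣binomial p-prime
          (ℕ.s≤s (subst (ℕ._< m) (sym (Fin.toℕ-inject₁ i)) (Fin.toℕ<n i))))

        first : term zero ≡ y ^ ℕ.suc m
        first = trans (×-homo-1 _) (*-identityˡ _)

        final : term (suc (fromℕ m)) ≡ x ^ ℕ.suc m
        final rewrite Fin.toℕ-fromℕ m | nCn≡1 (ℕ.suc m) | ℕ.n∸n≡0 m = trans (×-homo-1 _) (*-identityʳ _)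

    frobenius^-+ : ∀ i x y → (x + y) ^ (p ℕ.^ i) ≡ x ^ (p ℕ.^ i) + y ^ (p ℕ.^ i)
    frobenius^-+ ℕ.zero    x y = trans (*-identityʳ _) (sym (cong₂ _+_ (*-identityʳ x) (*-identityʳ y)))
    frobenius^-+ (ℕ.suc i) x y = begin
      (x + y) ^ (p ℕ.* p ℕ.^ i)                       ≡⟨ ^-assocʳ (x + y) p _ ⟨
      ((x + y) ^ p) ^ (p ℕ.^ i)                       ≡⟨ cong (_^ (p ℕ.^ i)) (frobenius-+ x y) ⟩
      (x ^ p + y ^ p) ^ (p ℕ.^ i)                     ≡⟨ frobenius^-+ i (x ^ p) (y ^ p) ⟩
      (x ^ p) ^ (p ℕ.^ i) + (y ^ p) ^ (p ℕ.^ i)       ≡⟨ cong₂ _+_ (^-assocʳ x p _) (^-assocʳ y p _) ⟩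
      x ^ (p ℕ.* p ℕ.^ i) + y ^ (p ℕ.* p ℕ.^ i)       ∎

-- Planar spreads

module PlanarSpreads
  {a b q n} (F : FiniteField a q) (K : FiniteField b n)
  (ι : FiniteField.Carrier F → FiniteField.Carrier K)
  where
  open FiniteField K using (Carrier; _+_; _*_; -_; _-_; 0#; 1#)
  open Field K using (+-assoc; +-comm; +-identityˡ; +-identityʳ; -‿inverseˡ; -‿inverseʳ;
    *-assoc; *-comm; *-identityˡ; *-identityʳ; distribˡ; distribʳ)
  open ScatteredPolynomials F K ι

  infixl 6 _-ᵥ_
  0ᵥ : V
  0ᵥ = 0# , 0#

  negate : V → V
  negate (x , y) = - x , - y

  _-ᵥ_ : V → V → V
  v -ᵥ w = v +ᵥ negate w

  _*ᵥ_ : V → V → V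
  (x , y) *ᵥ (x′ , y′) = x * x′ , y * y′

  -- The multiplication only serves to make the ring solver available for vectors.
  +ᵥ-*ᵥ-isCommutativeRing : IsCommutativeRing _≡_ _+ᵥ_ _*ᵥ_ negate 0ᵥ (1# , 1#)
  +ᵥ-*ᵥ-isCommutativeRing = record
    { isRing = record
      { +-isAbelianGroup = record
        { isGroup = record
          { isMonoid = record
            { isSemigroup = record
              { isMagma = isMagma _+ᵥ_
              ; assoc   = λ u v w → pair (+-assoc _ _ _) (+-assoc _ _ _) }
            ; identity = (λ v → pair (+-identityˡ _) (+-identityˡ _))
                       , (λ v → pair (+-identityʳ _) (+-identityʳ _)) }
          ; inverse = (λ v → pair (-‿inverseˡ _) (-‿inverseˡ _))
                    , (λ v → pair (-‿inverseʳ _) (-‿inverseʳ _))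
          ; ⁻¹-cong = cong negate }
        ; comm = λ v w → pair (+-comm _ _) (+-comm _ _) }
      ; *-cong     = cong₂ _*ᵥ_
      ; *-assoc    = λ u v w → pair (*-assoc _ _ _) (*-assoc _ _ _)
      ; *-identity = (λ v → pair (*-identityˡ _) (*-identityˡ _))
                   , (λ v → pair (*-identityʳ _) (*-identityʳ _))
      ; distrib    = (λ u v w → pair (distribˡ _ _ _) (distribˡ _ _ _))
                   , (λ u v w → pair (distribʳ _ _ _) (distribʳ _ _ _)) }
    ; *-comm = λ v w → pair (*-comm _ _) (*-comm _ _) }
    where
    pair : ∀ {x x′ y y′ : Carrier} → x ≡ x′ → y ≡ y′ → (x , y) ≡ (x′ , y′)
    pair = cong₂ _,_

  module ⱽ = IntegerCoefficients +ᵥ-*ᵥ-isCommutativeRing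
  open ⱽ using (_:+_; _:-_; :-_; _:=_; con)

  :0 : ∀ {k} → ⱽ.Polynomial k
  :0 = con (ℤ.+ 0)

  +ᵥ-cancelʳ : ∀ {v w u} → v +ᵥ u ≡ w +ᵥ u → v ≡ w
  +ᵥ-cancelʳ {v} {w} {u} eq = trans (sym (lemma v)) (trans (cong (_-ᵥ u) eq) (lemma w))
    where
    lemma : ∀ v → v +ᵥ u -ᵥ u ≡ v
    lemma v = ⱽ.solve 2 (λ v u → v :+ u :- u := v) refl v u

  Complementary : Subset → Subset → Set b
  Complementary W W′ =
      (∀ u → ∃[ w ] ∃[ w′ ] w ∈ W × w′ ∈ W′ × u ≡ w +ᵥ w′)
    × (∀ {u} → u ∈ W → u ∈ W′ → u ≡ 0ᵥ)

  -- `dichotomy` compares members by `_≐_`, because two predicates in the spread may describe the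
  -- same set without being equal. The recorded structure is that of additive subgroups, in which
  -- the additivity of collineations is proved; `proper` supplies a vector outside a component,
  -- `nontrivial` one that identifies it.
  record IsPlanarSpread (𝓢 : Pred Subset b) : Set (Level.suc b) where
    field
      0-closed   : ∀ {W} → W ∈ 𝓢 → 0ᵥ ∈ W
      subtract-closed   : ∀ {W} → W ∈ 𝓢 → ∀ {v w} → v ∈ W → w ∈ W → v -ᵥ w ∈ W
      cover      : ∀ v → ∃[ W ] W ∈ 𝓢 × v ∈ W
      dichotomy  : ∀ {W W′} → W ∈ 𝓢 → W′ ∈ 𝓢 → W ≐ W′ ⊎ Complementary W W′
      proper     : ∀ {W} → W ∈ 𝓢 → ∃[ v ] v ∉ W
      nontrivial : ∀ {W} → W ∈ 𝓢 → ∃[ v ] v ∈ W × v ≢ 0ᵥ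

    negate-closed : ∀ {W} → W ∈ 𝓢 → ∀ {v} → v ∈ W → negate v ∈ W
    negate-closed {W} W∈ {v} v∈ = subst (_∈ W)
      (ⱽ.solve 1 (λ v → :0 :- v := :- v) refl v)
      (subtract-closed W∈ (0-closed W∈) v∈)

    +-closed : ∀ {W} → W ∈ 𝓢 → ∀ {v w} → v ∈ W → w ∈ W → v +ᵥ w ∈ W
    +-closed {W} W∈ {v} {w} v∈ w∈ = subst (_∈ W)
      (ⱽ.solve 2 (λ v w → v :- (:- w) := v :+ w) refl v w)
      (subtract-closed W∈ v∈ (negate-closed W∈ w∈))

    unique : ∀ {W W′ v} → W ∈ 𝓢 → W′ ∈ 𝓢 → v ≢ 0ᵥ → v ∈ W → v ∈ W′ → W ≐ W′
    unique W∈ W′∈ v≢0 v∈W v∈W′ =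
      [ id , (λ (_ , trivial) → contradiction (trivial v∈W v∈W′) v≢0) ]′ (dichotomy W∈ W′∈)

    difference : ∀ {W u v w} → W ∈ 𝓢 → v ∈ translate W u → w ∈ translate W u → v -ᵥ w ∈ W
    difference {W} {u} W∈ (v₀ , v₀∈ , refl) (w₀ , w₀∈ , refl) = subst (_∈ W)
      (ⱽ.solve 3 (λ v w u → v :- w := (v :+ u) :- (w :+ u)) refl v₀ w₀ u)
      (subtract-closed W∈ v₀∈ w₀∈)

    shift-closed : ∀ {W u v w} → W ∈ 𝓢 → w ∈ W → v ∈ translate W u → w +ᵥ v ∈ translate W u
    shift-closed {u = u} {w = w} W∈ w∈ (v₀ , v₀∈ , refl) =
      w +ᵥ v₀ , +-closed W∈ w∈ v₀∈ ,
      ⱽ.solve 3 (λ w v u → w :+ (v :+ u) := w :+ v :+ u) refl w v₀ u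

  self∈translate : ∀ {W v} → 0ᵥ ∈ W → v ∈ translate W v
  self∈translate {v = v} 0∈ = 0ᵥ , 0∈ , ⱽ.solve 1 (λ v → v := :0 :+ v) refl v

  Additive : (V → V) → Set b
  Additive φ = ∀ v w → φ (v +ᵥ w) ≡ φ v +ᵥ φ w

  module _ {φ : V → V} (φ-+ : Additive φ) where
    additive⇒0 : φ 0ᵥ ≡ 0ᵥ
    additive⇒0 = +ᵥ-cancelʳ {u = φ 0ᵥ} (trans (sym (φ-+ 0ᵥ 0ᵥ))
      (trans (cong φ (ⱽ.solve 0 (:0 :+ :0 := :0) refl)) (ⱽ.solve 1 (λ v → v := :0 :+ v) refl (φ 0ᵥ))))

    additive⇒- : ∀ v w → φ (v -ᵥ w) ≡ φ v -ᵥ φ w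
    additive⇒- v w = +ᵥ-cancelʳ {u = φ w} (trans (sym (φ-+ (v -ᵥ w) w))
      (trans (cong φ (ⱽ.solve 2 (λ v w → v :- w :+ w := v) refl v w))
             (ⱽ.solve 2 (λ v w → v := v :- w :+ w) refl (φ v) (φ w))))

  MapsLinesToLines : Pred Subset b → Pred Subset b → (V → V) → Set (Level.suc b)
  MapsLinesToLines 𝓢 𝓢′ φ = ∀ {W} → W ∈ 𝓢 → ∀ v →
    ∃[ W′ ] W′ ∈ 𝓢′ × ∃[ u ] image φ (translate W v) ≐ translate W′ u

  MapsComponentsToComponents : Pred Subset b → Pred Subset b → (V → V) → Set (Level.suc b)
  MapsComponentsToComponents 𝓢 𝓢′ φ = ∀ {W} → W ∈ 𝓢 → ∃[ W′ ] W′ ∈ 𝓢′ × image φ W ≐ W′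

  -- Collineations fixing 0 are additive

  module Collineation
    {𝓢 𝓢′ : Pred Subset b} (spread : IsPlanarSpread 𝓢) (spread′ : IsPlanarSpread 𝓢′)
    {φ : V → V} (φ-injective : Injective _≡_ _≡_ φ) (φ0≡0 : φ 0ᵥ ≡ 0ᵥ)
    (φ-lines : MapsLinesToLines 𝓢 𝓢′ φ)
    where
    private
      module S  = IsPlanarSpread spread
      module S′ = IsPlanarSpread spread′

    -- The image of `W` is a coset of some member `W′`; it contains φ(0) = 0, hence it is `W′`
    -- itself.
    components : MapsComponentsToComponents 𝓢 𝓢′ φ
    components {W} W∈ =
      let W′ , W′∈ , u , sub , sup = φ-lines W∈ 0ᵥ
          0∈ : 0ᵥ ∈ translate W′ u
          0∈ = sub (0ᵥ , self∈translate (S.0-closed W∈) , sym φ0≡0)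

          to : ∀ {v} → v ∈ image φ W → v ∈ W′
          to (w , w∈ , v≡) = subst (_∈ W′)
            (trans (ⱽ.solve 1 (λ v → v :- :0 := v) refl (φ w)) (sym v≡))
            (S′.difference W′∈ (sub (w , (w , w∈ , +0 w) , refl)) 0∈)

          from : ∀ {v} → v ∈ W′ → v ∈ image φ W
          from {v} v∈ =
            let w , (w₀ , w₀∈ , w≡) , v≡ = sup (S′.shift-closed W′∈ v∈ 0∈)
            in w₀ , w₀∈ , trans (+0 v) (trans v≡ (cong φ (trans w≡ (sym (+0 w₀)))))
      in W′ , W′∈ , to , from
      where
      +0 : ∀ v → v ≡ v +ᵥ 0ᵥ
      +0 = ⱽ.solve 1 (λ v → v := v :+ :0) refl

    -- If the image of the coset W + v had a direction other than φ(W), it would meet φ(W).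
    increment : ∀ {W W′} → W ∈ 𝓢 → W′ ∈ 𝓢′ → image φ W ≐ W′ →
                ∀ v {w} → w ∈ W → φ (w +ᵥ v) -ᵥ φ v ∈ W′
    increment {W} {W′} W∈ W′∈ (φW⊆W′ , W′⊆φW) v {w} w∈ =
      let W″ , W″∈ , u , sub , sup = φ-lines W∈ v
          φv∈ = sub (v , self∈translate (S.0-closed W∈) , refl)
      in
      [ (λ (W″⊆W′ , _) → W″⊆W′ (S′.difference W″∈ (sub (w +ᵥ v , (w , w∈ , refl) , refl)) φv∈))
      , (λ (decompose , _) →
          -- The vector w′ = φ(v) - w″ lies in φ(W + v) and in φ(W), so injectivity puts v into W.
          -- The claim then holds because both images lie in `W′`.
          let w″ , w′ , w″∈ , w′∈ , φv≡ = decompose (φ v)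
              x , (x₀ , x₀∈ , x≡) , eq = sup (S′.shift-closed W″∈ (S′.negate-closed W″∈ w″∈) φv∈)
              y , y∈ , w′≡ = W′⊆φW w′∈
              y≡x = φ-injective (trans (sym w′≡) (trans
                (trans (ⱽ.solve 2 (λ p q → q := :- p :+ (p :+ q)) refl w″ w′)
                       (cong (negate w″ +ᵥ_) (sym φv≡)))
                eq))
              v∈ = subst (_∈ W)
                (trans (cong (_-ᵥ x₀) (trans y≡x x≡))
                       (ⱽ.solve 2 (λ p v → p :+ v :- p := v) refl x₀ v))
                (S.subtract-closed W∈ y∈ x₀∈)
          in S′.subtract-closed W′∈ (φW⊆W′ (w +ᵥ v , S.+-closed W∈ w∈ v∈ , refl))
                                    (φW⊆W′ (v , v∈ , refl)))
      ]′ (S′.dichotomy W″∈ W′∈)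

    private
      -- By `increment` in both directions, the defect `d` of additivity lies in φ(W₁) and in φ(W₂).
      -- As φ is injective and W₁ and W₂ meet only in 0, so do their images.
      additive-transversal : ∀ {W₁ W₂ v w} → W₁ ∈ 𝓢 → W₂ ∈ 𝓢 → Complementary W₁ W₂ →
                             v ∈ W₁ → w ∈ W₂ → φ (v +ᵥ w) ≡ φ v +ᵥ φ w
      additive-transversal {W₁} {W₂} {v} {w} W₁∈ W₂∈ (_ , trivial) v∈ w∈ = trans
          (ⱽ.solve 3 (λ p q r → p := p :- q :- r :+ (r :+ q)) refl (φ (v +ᵥ w)) (φ w) (φ v))
          (trans (cong (_+ᵥ (φ v +ᵥ φ w)) d≡0) (ⱽ.solve 1 (λ v → :0 :+ v := v) refl (φ v +ᵥ φ w)))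
        where
        d : V
        d = φ (v +ᵥ w) -ᵥ φ w -ᵥ φ v

        d∈₁ : d ∈ image φ W₁
        d∈₁ = let W₁′ , W₁′∈ , sub , sup = components W₁∈ in
          sup (S′.subtract-closed W₁′∈ (increment W₁∈ W₁′∈ (sub , sup) w v∈) (sub (v , v∈ , refl)))

        d∈₂ : d ∈ image φ W₂
        d∈₂ = let W₂′ , W₂′∈ , sub , sup = components W₂∈ in subst (_∈ image φ W₂)
          (trans (cong (λ z → φ z -ᵥ φ v -ᵥ φ w) (ⱽ.solve 2 (λ p q → p :+ q := q :+ p) refl w v))
                 (ⱽ.solve 3 (λ p q r → p :- q :- r := p :- r :- q) refl (φ (v +ᵥ w)) (φ v) (φ w)))
          (sup (S′.subtract-closed W₂′∈ (increment W₂∈ W₂′∈ (sub , sup) v w∈) (sub (w , w∈ , refl))))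

        d≡0 : d ≡ 0ᵥ
        d≡0 =
          let x , x∈ , d≡φx = d∈₁
              y , y∈ , d≡φy = d∈₂
              y≡x = φ-injective (trans (sym d≡φy) d≡φx)
          in trans d≡φx (trans (cong φ (trivial x∈ (subst (_∈ W₂) y≡x y∈))) φ0≡0)

      -- Vectors v, w of one component are added through a third vector z outside it.
      additive-longitudinal : ∀ {W v w} → W ∈ 𝓢 → v ∈ W → w ∈ W → φ (v +ᵥ w) ≡ φ v +ᵥ φ w
      additive-longitudinal {W} {v} {w} W∈ v∈ w∈ = +ᵥ-cancelʳ {u = φ z} (begin
        φ (v +ᵥ w) +ᵥ φ z     ≡⟨ through-z (S.+-closed W∈ v∈ w∈) z∉ ⟨
        φ (v +ᵥ w +ᵥ z)       ≡⟨ cong φ (ⱽ.solve 3 (λ v w z → v :+ w :+ z := v :+ (w :+ z)) refl v w z) ⟩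
        φ (v +ᵥ (w +ᵥ z))     ≡⟨ through-z v∈ w+z∉ ⟩
        φ v +ᵥ φ (w +ᵥ z)     ≡⟨ cong (φ v +ᵥ_) (through-z w∈ z∉) ⟩
        φ v +ᵥ (φ w +ᵥ φ z)   ≡⟨ ⱽ.solve 3 (λ v w z → v :+ (w :+ z) := v :+ w :+ z) refl (φ v) (φ w) (φ z) ⟩
        φ v +ᵥ φ w +ᵥ φ z     ∎)
        where
        open ≡-Reasoning
        z = proj₁ (S.proper W∈)
        z∉ = proj₂ (S.proper W∈)

        w+z∉ : w +ᵥ z ∉ W
        w+z∉ w+z∈ = z∉ (subst (_∈ W) (ⱽ.solve 2 (λ w z → w :+ z :- w := z) refl w z)
          (S.subtract-closed W∈ w+z∈ w∈))

        through-z : ∀ {x y} → x ∈ W → y ∉ W → φ (x +ᵥ y) ≡ φ x +ᵥ φ y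
        through-z {y = y} x∈ y∉ =
          let W₂ , W₂∈ , y∈ = S.cover y in
          [ (λ (_ , W₂⊆W) → contradiction (W₂⊆W y∈) y∉)
          , (λ complementary → additive-transversal W∈ W₂∈ complementary x∈ y∈)
          ]′ (S.dichotomy W∈ W₂∈)

    additive : Additive φ
    additive v w =
      let W₁ , W₁∈ , v∈ = S.cover v
          W₂ , W₂∈ , w∈ = S.cover w
      in
      [ (λ (_ , W₂⊆W₁) → additive-longitudinal W₁∈ v∈ (W₂⊆W₁ w∈))
      , (λ complementary → additive-transversal W₁∈ W₂∈ complementary v∈ w∈)
      ]′ (S.dichotomy W₁∈ W₂∈)

-- Isomorphisms of translation planes and affine maps

module PlaneIsomorphisms
  {a b q n} (F : FiniteField a q) (K : FiniteField b n)
  (ι : FiniteField.Carrier F → FiniteField.Carrier K)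
  where
  open ScatteredPolynomials F K ι
  open PlanarSpreads F K ι
  open ⱽ using (_:+_; _:-_; _:=_)

  module _ {𝓢 𝓢′ : Pred Subset b} (spread : IsPlanarSpread 𝓢) (spread′ : IsPlanarSpread 𝓢′)
           (α : V ⤖ V)
    where
    open Bijection α using (to; injective; surjective)
    private
      module S  = IsPlanarSpread spread
      module S′ = IsPlanarSpread spread′

    isomorphism⇒mapsLinesToLines :
      IsPlaneIsomorphism (translationPlane 𝓢) (translationPlane 𝓢′) α →
      MapsLinesToLines 𝓢 𝓢′ (λ v → to v -ᵥ to 0ᵥ)
    isomorphism⇒mapsLinesToLines (lines , _) {W} W∈ v =
      let W′ , W′∈ , u , sub , sup = lines (translate W v) (W , W∈ , v , id , id) in
      W′ , W′∈ , u -ᵥ to 0ᵥ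
      , (λ (x , x∈ , y≡) →
          let w , w∈ , αx≡ = sub (x , x∈ , refl) in
          w , w∈ , trans y≡ (trans (cong (_-ᵥ to 0ᵥ) αx≡)
            (ⱽ.solve 3 (λ w u o → w :+ u :- o := w :+ (u :- o)) refl w u (to 0ᵥ))))
      , (λ {y} (w , w∈ , y≡) →
          let x , x∈ , eq = sup (w , w∈ , refl) in
          x , x∈ , trans y≡ (trans
            (ⱽ.solve 3 (λ w u o → w :+ (u :- o) := w :+ u :- o) refl w u (to 0ᵥ))
            (cong (_-ᵥ to 0ᵥ) eq)))

    affine⇒isomorphism : ∀ {φ u} → Additive φ → MapsComponentsToComponents 𝓢 𝓢′ φ →
      (∀ v → to v ≡ φ v +ᵥ u) →
      IsPlaneIsomorphism (translationPlane 𝓢) (translationPlane 𝓢′) α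
    affine⇒isomorphism {φ} {u} φ-+ components to≡ = image-line , preimage-line
      where
      φ-injective : Injective _≡_ _≡_ φ
      φ-injective eq = injective (trans (to≡ _) (trans (cong (_+ᵥ u) eq) (sym (to≡ _))))

      φ-surjective : ∀ v → ∃[ w ] φ w ≡ v
      φ-surjective v = let w , eq = surjective (v +ᵥ u) in
        w , +ᵥ-cancelʳ (trans (sym (to≡ w)) (eq refl))

      image-line : ∀ l → l ∈ Line (translationPlane 𝓢) → image to l ∈ Line (translationPlane 𝓢′)
      image-line l (W , W∈ , w , l⊆ , ⊆l) =
        let W′ , W′∈ , sub , sup = components W∈ in
        W′ , W′∈ , φ w +ᵥ u
        , (λ (x , x∈l , y≡) →
            let x₀ , x₀∈ , x≡ = l⊆ x∈l in
            φ x₀ , sub (x₀ , x₀∈ , refl) , trans y≡ (trans (cong to x≡) (to-+ x₀ w)))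
        , (λ {y} (w′ , w′∈ , y≡) →
            let x₀ , x₀∈ , w′≡ = sup w′∈ in
            x₀ +ᵥ w , ⊆l (x₀ , x₀∈ , refl)
            , trans y≡ (trans (cong (_+ᵥ (φ w +ᵥ u)) w′≡) (sym (to-+ x₀ w))))
        where
        to-+ : ∀ x w → to (x +ᵥ w) ≡ φ x +ᵥ (φ w +ᵥ u)
        to-+ x w = trans (to≡ (x +ᵥ w)) (trans (cong (_+ᵥ u) (φ-+ x w))
          (ⱽ.solve 3 (λ x w u → x :+ w :+ u := x :+ (w :+ u)) refl (φ x) (φ w) u))

      -- Pull a nonzero vector of `W′` back and take the component through it. Its image is a member
      -- of the spread that shares this vector with `W′`, so the two coincide.
      component-preimage : ∀ {W′} → W′ ∈ 𝓢′ → ∃[ W ] W ∈ 𝓢 × image φ W ≐ W′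
      component-preimage {W′} W′∈ =
        let e′ , e′∈ , e′≢0 = S′.nontrivial W′∈
            e , φe≡e′ = φ-surjective e′
            W , W∈ , e∈ = S.cover e
            W″ , W″∈ , sub , sup = components W∈
            W″⊆W′ , W′⊆W″ = S′.unique W″∈ W′∈ e′≢0 (sub (e , e∈ , sym φe≡e′)) e′∈
        in W , W∈ , (λ y∈ → W″⊆W′ (sub y∈)) , (λ y∈ → sup (W′⊆W″ y∈))

      preimage-line : ∀ l′ → l′ ∈ Line (translationPlane 𝓢′) → (to ⊢ l′) ∈ Line (translationPlane 𝓢)
      preimage-line l′ (W′ , W′∈ , w′ , l′⊆ , ⊆l′) =
        let W , W∈ , sub , sup = component-preimage W′∈
            w , tow = surjective w′
            to-difference : ∀ v → to v ≡ φ (v -ᵥ w) +ᵥ w′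
            to-difference v = trans (to≡ v) (trans
              (ⱽ.solve 3 (λ x y u → x :+ u := x :- y :+ (y :+ u)) refl (φ v) (φ w) u)
              (cong₂ _+ᵥ_ (sym (additive⇒- φ-+ v w)) (trans (sym (to≡ w)) (tow refl))))
        in W , W∈ , w
        , (λ {v} tov∈ →
            let y , y∈ , tov≡ = l′⊆ tov∈
                x , x∈ , y≡ = sup y∈
                v-w≡x : v -ᵥ w ≡ x
                v-w≡x = φ-injective (trans
                  (+ᵥ-cancelʳ (trans (sym (to-difference v)) tov≡)) y≡)
            in x , x∈ , trans (ⱽ.solve 2 (λ v w → v := v :- w :+ w) refl v w) (cong (_+ᵥ w) v-w≡x))
        , (λ {v} (x , x∈ , v≡) → ⊆l′
            ( φ x , sub (x , x∈ , refl)
            , trans (to-difference v) (cong (λ z → φ z +ᵥ w′)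
                (trans (cong (_-ᵥ w) v≡) (ⱽ.solve 2 (λ x w → x :+ w :- w := x) refl x w)))))

-- Linearized polynomials and multiples of their graphs

module ScatteredSpread
  {a b q t} (q-primePower : IsPrimePower q)
  (F : FiniteField a q) (K : FiniteField b (q ℕ.^ t))
  (ι : FiniteField.Carrier F → FiniteField.Carrier K) (embedding : IsSubfieldEmbedding F K ι)
  where
  open FiniteField K using (Carrier; _+_; _*_; -_; _-_; 0#; 1#; _^_; cardinality; inverse)
  open Field K
  open ScatteredPolynomials F K ι
  open PlanarSpreads F K ι
  open SemiringSum semiring using (sum-cong-≗; ∑-distrib-+; *-distribˡ-sum)
  open CommutativeExp commutativeSemiring using (^-distrib-*)
  open ≡-Reasoning
  open RingMorphisms.IsRingMonomorphism embedding public
    using () renaming (+-homo to ι-+; *-homo to ι-*; 0#-homo to ι-0; 1#-homo to ι-1; -‿homo to ι-neg; injective to ι-injective)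

  module 𝔽 where
    open FiniteField F public
    open Field F public

  ι≢0 : ∀ {c} → c ≢ 𝔽.0# → ι c ≢ 0#
  ι≢0 c≢0 eq = c≢0 (ι-injective (trans eq (sym ι-0)))

  ι-^ : ∀ c k → ι (c 𝔽.^ k) ≡ ι c ^ k
  ι-^ c ℕ.zero    = ι-1
  ι-^ c (ℕ.suc k) = trans (ι-* c _) (cong (ι c *_) (ι-^ c k))

  private
    p k : ℕ
    p = proj₁ q-primePower
    k = ℕ.suc (proj₁ (proj₂ q-primePower))

    q≡p^k : q ≡ p ℕ.^ k
    q≡p^k = proj₂ (proj₂ (proj₂ q-primePower))

    q^≡p^ : ∀ i → q ℕ.^ i ≡ p ℕ.^ (k ℕ.* i)
    q^≡p^ i = trans (cong (ℕ._^ i) q≡p^k) (ℕ.^-*-assoc p k i)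

  -- As K has a power of p as its order, x ↦ x^(q^i) is an iterate of the Frobenius map x ↦ x^p.
  ^q^-+ : ∀ i x y → (x + y) ^ (q ℕ.^ i) ≡ x ^ (q ℕ.^ i) + y ^ (q ℕ.^ i)
  ^q^-+ i x y rewrite q^≡p^ i =
    Frobenius.frobenius^-+ K {j = k ℕ.* t} (proj₁ (proj₂ (proj₂ q-primePower))) (q^≡p^ t) (k ℕ.* i) x y

  -- Inside F, which has q elements, `^order` gives c^q = c; this is iterated and carried over by ι.
  ι-^q^ : ∀ i c → ι c ^ (q ℕ.^ i) ≡ ι c
  ι-^q^ i c = trans (sym (ι-^ c (q ℕ.^ i))) (cong ι (fixed i))
    where
    open Exp 𝔽.semiring using (^-assocʳ)
    fixed : ∀ i → c 𝔽.^ (q ℕ.^ i) ≡ c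
    fixed ℕ.zero    = 𝔽.*-identityʳ c
    fixed (ℕ.suc i) = trans (sym (^-assocʳ c q (q ℕ.^ i)))
      (trans (cong (𝔽._^ (q ℕ.^ i)) (Frobenius.^order F c)) (fixed i))

  module _ (f : LinearizedPolynomial) where
    open LinearizedPolynomial f using (coefficient)

    ⟦⟧-+ : ∀ x y → ⟦ f ⟧ (x + y) ≡ ⟦ f ⟧ x + ⟦ f ⟧ y
    ⟦⟧-+ x y = trans
      (sum-cong-≗ λ i → trans (cong (coefficient i *_) (^q^-+ (toℕ i) x y)) (distribˡ (coefficient i) _ _))
      (∑-distrib-+ (λ i → coefficient i * x ^ (q ℕ.^ toℕ i)) (λ i → coefficient i * y ^ (q ℕ.^ toℕ i)))

    ⟦⟧-ι : ∀ c x → ⟦ f ⟧ (ι c * x) ≡ ι c * ⟦ f ⟧ x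
    ⟦⟧-ι c x = trans
      (sum-cong-≗ λ i → begin
        coefficient i * (ι c * x) ^ (q ℕ.^ toℕ i)
          ≡⟨ cong (coefficient i *_) (^-distrib-* (ι c) x (q ℕ.^ toℕ i)) ⟩
        coefficient i * (ι c ^ (q ℕ.^ toℕ i) * x ^ (q ℕ.^ toℕ i))
          ≡⟨ cong (λ u → coefficient i * (u * x ^ (q ℕ.^ toℕ i))) (ι-^q^ (toℕ i) c) ⟩
        coefficient i * (ι c * x ^ (q ℕ.^ toℕ i))
          ≡⟨ solve 3 (λ u v w → u :* (v :* w) := v :* (u :* w)) refl (coefficient i) (ι c) _ ⟩
        ι c * (coefficient i * x ^ (q ℕ.^ toℕ i)) ∎)
      (sym (*-distribˡ-sum (ι c) (λ i → coefficient i * x ^ (q ℕ.^ toℕ i))))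

    ⟦⟧-0 : ⟦ f ⟧ 0# ≡ 0#
    ⟦⟧-0 = trans (solve 1 (λ u → u := (u :+ u) :- u) refl (⟦ f ⟧ 0#))
      (trans (cong (_- ⟦ f ⟧ 0#) (trans (sym (⟦⟧-+ 0# 0#)) (cong ⟦ f ⟧ (+-identityˡ 0#)))) (-‿inverseʳ _))

    -- Together with `∈L⇐` this replaces the quotient by a division-free condition: the line of
    -- slope m meets `U f` outside 0. In this form membership is decided by search.
    ∈L⇒ : ∀ {m} → m ∈ L f → ∃[ x ] x ≢ 0# × ⟦ f ⟧ x ≡ m * x
    ∈L⇒ (x , x≢0 , refl) = x , x≢0 , trans
      (trans (sym (*-identityʳ _)) (cong (⟦ f ⟧ x *_) (sym (inverseˡ x x≢0)))) (sym (*-assoc _ _ _))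

    ∈L⇐ : ∀ {m x} → x ≢ 0# → ⟦ f ⟧ x ≡ m * x → m ∈ L f
    ∈L⇐ {m} {x} x≢0 eq = x , x≢0 , *-cancelˡ x≢0 (begin
      x * m                             ≡⟨ *-comm x m ⟩
      m * x                             ≡⟨ eq ⟨
      ⟦ f ⟧ x                           ≡⟨ *-identityˡ _ ⟨
      1# * ⟦ f ⟧ x                      ≡⟨ cong (_* ⟦ f ⟧ x) (inverseˡ x x≢0) ⟨
      inverse x x≢0 * x * ⟦ f ⟧ x       ≡⟨ solve 3 (λ i x y → i :* x :* y := x :* (y :* i)) refl (inverse x x≢0) x (⟦ f ⟧ x) ⟩
      x * (⟦ f ⟧ x * inverse x x≢0)     ∎)

    _∈L? : ∀ m → Dec (m ∈ L f)
    m ∈L? = map′ (λ (x , x≢0 , eq) → ∈L⇐ x≢0 eq) ∈L⇒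
      (∃? cardinality λ x → ¬? (x ≟ 0#) ×-dec (⟦ f ⟧ x ≟ m * x))

    scaledU : Carrier → Carrier → V
    scaledU h x = h * x , h * ⟦ f ⟧ x

    ∈scaleU⇒ : ∀ {h v} → v ∈ scale h (U f) → ∃[ x ] v ≡ scaledU h x
    ∈scaleU⇒ (_ , (x , refl) , refl) = x , refl

    ∈scaleU⇐ : ∀ {h v} x → v ≡ scaledU h x → v ∈ scale h (U f)
    ∈scaleU⇐ x refl = _ , (x , refl) , refl

    scaledU-ι : ∀ h c x → scaledU (h * ι c) x ≡ scaledU h (ι c * x)
    scaledU-ι h c x = cong₂ _,_ (*-assoc h (ι c) x)
      (trans (*-assoc h (ι c) _) (cong (h *_) (sym (⟦⟧-ι c x))))

    -- Since `U f` is an 𝔽_q-subspace, h matters only up to a factor in 𝔽_q^*. This lets every mark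
    -- h·c stand for the same component when lost slopes are counted.
    scale-ι : ∀ h {c} → c ≢ 𝔽.0# → scale (h * ι c) (U f) ≐ scale h (U f)
    scale-ι h {c} c≢0 =
        (λ v∈ → let x , v≡ = ∈scaleU⇒ v∈ in ∈scaleU⇐ (ι c * x) (trans v≡ (scaledU-ι h c x)))
      , (λ v∈ → let x , v≡ = ∈scaleU⇒ v∈ ; y , cy≡x = divide (ι≢0 c≢0) x in
          ∈scaleU⇐ y (trans v≡ (trans (cong (scaledU h) (sym cy≡x)) (sym (scaledU-ι h c y)))))

    module _ (scattered : IsScattered f) where
      -- In a dependence c y + d x = 0 the coefficient c cannot vanish, for then d x = 0 with d and
      -- x nonzero; so y / x = - d / c lies in 𝔽_q.
      scattered-ratio : ∀ {x y} → x ≢ 0# → y ≢ 0# → x * ⟦ f ⟧ y ≡ y * ⟦ f ⟧ x →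
                        ∃[ c ] c ≢ 𝔽.0# × y ≡ x * ι c
      scattered-ratio {x} {y} x≢0 y≢0 eq =
        let c , d , nontrivial , dependent = scattered y x (≡⇒-≡0 eq)
            c≢0 : c ≢ 𝔽.0#
            c≢0 c≡0 = nontrivial (c≡0 , decidable-stable (d 𝔽.≟ 𝔽.0#) λ d≢0 →
              *-nonzero (ι≢0 d≢0) x≢0 (begin
                ι d * x               ≡⟨ solve 2 (λ u v → u := con (ℤ.+ 0) :* v :+ u) refl (ι d * x) y ⟩
                0# * y + ι d * x      ≡⟨ cong (λ u → u * y + ι d * x) (trans (cong ι c≡0) ι-0) ⟨
                ι c * y + ι d * x     ≡⟨ dependent ⟩
                0#                    ∎))
            e , ce≡ = 𝔽.divide c≢0 (𝔽.- d)
            y≡ : y ≡ x * ι e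
            y≡ = *-cancelˡ (ι≢0 c≢0) (begin
              ι c * y                     ≡⟨ solve 2 (λ u v → u := u :+ v :- v) refl (ι c * y) (ι d * x) ⟩
              ι c * y + ι d * x - ι d * x ≡⟨ cong (_- ι d * x) dependent ⟩
              0# - ι d * x                ≡⟨ solve 2 (λ u v → con (ℤ.+ 0) :- u :* v := (:- u) :* v) refl (ι d) x ⟩
              - ι d * x                   ≡⟨ cong (_* x) (ι-neg d) ⟨
              ι (𝔽.- d) * x               ≡⟨ cong (λ u → ι u * x) ce≡ ⟨
              ι (c 𝔽.* e) * x             ≡⟨ cong (_* x) (ι-* c e) ⟩
              ι c * ι e * x               ≡⟨ solve 3 (λ u v w → u :* v :* w := u :* (w :* v)) refl (ι c) (ι e) x ⟩
              ι c * (x * ι e)             ∎)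
        in e , (λ e≡0 → y≢0 (trans y≡ (trans (cong (λ u → x * ι u) e≡0) (trans (cong (x *_) ι-0) (zeroʳ x))))) , y≡

-- `𝓑 f` is a planar spread

module SpreadOfPolynomial
  {a b q t} (q-primePower : IsPrimePower q)
  (F : FiniteField a q) (K : FiniteField b (q ℕ.^ t))
  (ι : FiniteField.Carrier F → FiniteField.Carrier K) (embedding : IsSubfieldEmbedding F K ι)
  (f : ScatteredPolynomials.LinearizedPolynomial F K ι) (scattered : ScatteredPolynomials.IsScattered F K ι f)
  where
  open FiniteField K using (Carrier; _+_; _*_; _-_; 0#; 1#; cardinality)
  open Field K
  open ScatteredPolynomials F K ι
  open PlanarSpreads F K ι
  open ScatteredSpread {t = t} q-primePower F K ι embedding

  infix 4 _≟ᵥ_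
  _≟ᵥ_ : DecidableEquality V
  _≟ᵥ_ = ≡-dec _≟_ _≟_

  -- An index type for the members, so that each is parametrised by K through the additive injection
  -- `point`. All members thus have the same size, and complementarity becomes a matter of counting.
  data Component : Set b where
    slope    : ∀ m → m ∉ L f → Component
    multiple : ∀ h → h ≢ 0# → Component
    vertical : Component

  point : Component → Carrier → V
  point (slope m _)    x = x ·ᵥ (1# , m)
  point (multiple h _) x = scaledU f h x
  point vertical       x = 0# , x

  Points : Component → Subset
  Points c v = ∃[ x ] v ≡ point c x

  private
    Points-multiple : ∀ {h} h≢0 → scale h (U f) ≐ Points (multiple h h≢0)
    Points-multiple h≢0 = (λ v∈ → ∈scaleU⇒ f v∈) , (λ (x , v≡) → ∈scaleU⇐ f x v≡)

    Points-vertical : verticalAxis ≐ Points vertical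
    Points-vertical = (λ {v} x≡0 → proj₂ v , cong (_, proj₂ v) x≡0) , (λ (x , v≡) → cong proj₁ v≡)

  component : ∀ {W} → W ∈ 𝓑 f → ∃[ c ] W ≐ Points c
  component (inj₁ (m , m∉ , W≐))         = slope m m∉ , W≐
  component (inj₂ (inj₁ (h , h≢0 , W≐))) = multiple h h≢0 , ≐-trans W≐ (Points-multiple h≢0)
  component (inj₂ (inj₂ W≐))             = vertical , ≐-trans W≐ Points-vertical

  Points∈𝓑 : ∀ c → ∃[ W ] W ∈ 𝓑 f × W ≐ Points c
  Points∈𝓑 (slope m m∉)     = span (1# , m) , inj₁ (m , m∉ , ≐-refl) , ≐-refl
  Points∈𝓑 (multiple h h≢0) = scale h (U f) , inj₂ (inj₁ (h , h≢0 , ≐-refl)) , Points-multiple h≢0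
  Points∈𝓑 vertical         = verticalAxis , inj₂ (inj₂ ≐-refl) , Points-vertical

  point-+ : ∀ c x y → point c (x + y) ≡ point c x +ᵥ point c y
  point-+ (slope m _)    x y = cong₂ _,_ (distribʳ 1# x y) (distribʳ m x y)
  point-+ (multiple h _) x y = cong₂ _,_ (distribˡ h x y)
    (trans (cong (h *_) (⟦⟧-+ f x y)) (distribˡ h _ _))
  point-+ vertical       x y = cong₂ _,_ (sym (+-identityˡ 0#)) refl

  point-0 : ∀ c → point c 0# ≡ 0ᵥ
  point-0 (slope m _)    = cong₂ _,_ (zeroˡ 1#) (zeroˡ m)
  point-0 (multiple h _) = cong₂ _,_ (zeroʳ h) (trans (cong (h *_) (⟦⟧-0 f)) (zeroʳ h))
  point-0 vertical       = refl

  point-sub : ∀ c x y → point c (x - y) ≡ point c x -ᵥ point c y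
  point-sub c x y = +ᵥ-cancelʳ {u = point c y} (trans (sym (point-+ c (x - y) y))
    (trans (cong (point c) (solve 2 (λ x y → x :- y :+ y := x) refl x y))
           (ⱽ.solve 2 (λ x y → x ⱽ.:= x ⱽ.:- y ⱽ.:+ y) refl (point c x) (point c y))))

  point-injective : ∀ c {x y} → point c x ≡ point c y → x ≡ y
  point-injective (slope m _)      eq = trans (sym (*-identityʳ _)) (trans (cong proj₁ eq) (*-identityʳ _))
  point-injective (multiple h h≢0) eq = *-cancelˡ h≢0 (cong proj₁ eq)
  point-injective vertical         eq = cong proj₂ eq

  private
    slope-multiple-disjoint : ∀ {m h x y} → m ∉ L f → h ≢ 0# → x ≢ 0# → x ·ᵥ (1# , m) ≢ scaledU f h y
    slope-multiple-disjoint {m} {h} {x} {y} m∉ h≢0 x≢0 eq = m∉ (∈L⇐ f y≢0 (*-cancelˡ h≢0 (begin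
      h * ⟦ f ⟧ y   ≡⟨ cong proj₂ eq ⟨
      x * m         ≡⟨ cong (_* m) x≡hy ⟩
      h * y * m     ≡⟨ solve 3 (λ h y m → h :* y :* m := h :* (m :* y)) refl h y m ⟩
      h * (m * y)   ∎)))
      where
      open ≡-Reasoning
      x≡hy : x ≡ h * y
      x≡hy = trans (sym (*-identityʳ x)) (cong proj₁ eq)
      y≢0 : y ≢ 0#
      y≢0 y≡0 = x≢0 (trans x≡hy (trans (cong (h *_) y≡0) (zeroʳ h)))

    point≢0 : ∀ c {x} → x ≢ 0# → point c x ≢ 0ᵥ
    point≢0 c x≢0 eq = x≢0 (point-injective c (trans eq (sym (point-0 c))))

  -- Members of different kinds cannot meet outside 0. If hU_f and h′U_f share (h x, h f(x)) = (h′
  -- y, h′ f(y)), then f(x)/x = f(y)/y, so y / x = h / h′ lies in 𝔽_q^* and `scale-ι` identifies the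
  -- two.
  meet⇒≐ : ∀ c c′ {x y} → x ≢ 0# → y ≢ 0# → point c x ≡ point c′ y → Points c ≐ Points c′
  meet⇒≐ (slope m m∉) (slope m′ m∉′) {x} {y} x≢0 y≢0 eq with *-cancelˡ x≢0 (begin
      x * m    ≡⟨ cong proj₂ eq ⟩
      y * m′   ≡⟨ cong (_* m′) (trans (sym (*-identityʳ y)) (trans (sym (cong proj₁ eq)) (*-identityʳ x))) ⟩
      x * m′   ∎)
    where open ≡-Reasoning
  ... | refl = ≐-refl
  meet⇒≐ (slope m m∉) (multiple h h≢0) x≢0 y≢0 eq =
    contradiction eq (slope-multiple-disjoint m∉ h≢0 x≢0)
  meet⇒≐ (multiple h h≢0) (slope m m∉) x≢0 y≢0 eq =
    contradiction (sym eq) (slope-multiple-disjoint m∉ h≢0 y≢0)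
  meet⇒≐ (slope m m∉) vertical x≢0 y≢0 eq =
    contradiction (trans (sym (*-identityʳ _)) (cong proj₁ eq)) x≢0
  meet⇒≐ vertical (slope m m∉) x≢0 y≢0 eq =
    contradiction (trans (sym (*-identityʳ _)) (sym (cong proj₁ eq))) y≢0
  meet⇒≐ (multiple h h≢0) vertical x≢0 y≢0 eq =
    contradiction (cong proj₁ eq) (*-nonzero h≢0 x≢0)
  meet⇒≐ vertical (multiple h h≢0) x≢0 y≢0 eq =
    contradiction (sym (cong proj₁ eq)) (*-nonzero h≢0 y≢0)
  meet⇒≐ vertical vertical x≢0 y≢0 eq = ≐-refl
  meet⇒≐ (multiple h h≢0) (multiple h′ h′≢0) {x} {y} x≢0 y≢0 eq =
    ≐-trans (≐-sym (Points-multiple h≢0))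
      (≐-trans (subst (λ u → scale u (U f) ≐ scale h′ (U f)) (sym h≡) (scale-ι f h′ e≢0)) (Points-multiple h′≢0))
    where
    open ≡-Reasoning
    proportional : x * ⟦ f ⟧ y ≡ y * ⟦ f ⟧ x
    proportional = *-cancelˡ (*-nonzero h≢0 h′≢0) (begin
      h * h′ * (x * ⟦ f ⟧ y)   ≡⟨ solve 4 (λ h k x z → h :* k :* (x :* z) := (h :* x) :* (k :* z)) refl h h′ x _ ⟩
      h * x * (h′ * ⟦ f ⟧ y)   ≡⟨ cong₂ _*_ (cong proj₁ eq) (sym (cong proj₂ eq)) ⟩
      h′ * y * (h * ⟦ f ⟧ x)   ≡⟨ solve 4 (λ h k y z → (k :* y) :* (h :* z) := h :* k :* (y :* z)) refl h h′ y _ ⟩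
      h * h′ * (y * ⟦ f ⟧ x)   ∎)
    ratio = scattered-ratio f scattered x≢0 y≢0 proportional
    e     = proj₁ ratio
    e≢0   = proj₁ (proj₂ ratio)
    h≡ : h ≡ h′ * ι e
    h≡ = *-cancelˡ x≢0 (begin
      x * h            ≡⟨ *-comm x h ⟩
      h * x            ≡⟨ cong proj₁ eq ⟩
      h′ * y           ≡⟨ cong (h′ *_) (proj₂ (proj₂ ratio)) ⟩
      h′ * (x * ι e)   ≡⟨ solve 3 (λ h x e → h :* (x :* e) := x :* (h :* e)) refl h′ x (ι e) ⟩
      x * (h′ * ι e)   ∎)

  private
    -- When there is no common nonzero vector, adding a point of each member is an injective map
    -- from K × K to V. These sets are the same finite set, so it is also surjective.
    dichotomy : ∀ c c′ → Points c ≐ Points c′ ⊎ Complementary (Points c) (Points c′)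
    dichotomy c c′ with ∃? cardinality (λ x → ¬? (x ≟ 0#) ×-dec ∃? cardinality λ y → point c x ≟ᵥ point c′ y)
    ... | yes (x , x≢0 , y , eq) = inj₁ (meet⇒≐ c c′ x≢0
      (λ y≡0 → point≢0 c x≢0 (trans eq (trans (cong (point c′) y≡0) (point-0 c′)))) eq)
    ... | no ∄x = inj₂ (decompose , trivial)
      where
      meet : ∀ {x y} → point c x ≡ point c′ y → x ≡ 0#
      meet {x} {y} eq = decidable-stable (x ≟ 0#) λ x≢0 → ∄x (x , x≢0 , y , eq)

      trivial : ∀ {u} → u ∈ Points c → u ∈ Points c′ → u ≡ 0ᵥ
      trivial (x , u≡) (y , u≡′) = trans u≡ (trans (cong (point c) (meet (trans (sym u≡) u≡′))) (point-0 c))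

      total : V → V
      total (x , y) = point c x +ᵥ point c′ y

      total-injective : Injective _≡_ _≡_ total
      total-injective {x , y} {x′ , y′} eq = cong₂ _,_ x≡x′ (sym (point-injective c′ (+ᵥ-cancelʳ (begin
        point c′ y′ +ᵥ point c x    ≡⟨ ⱽ.solve 2 (λ v w → v ⱽ.:+ w ⱽ.:= w ⱽ.:+ v) refl (point c′ y′) (point c x) ⟩
        point c x +ᵥ point c′ y′    ≡⟨ cong (λ u → point c u +ᵥ point c′ y′) x≡x′ ⟩
        point c x′ +ᵥ point c′ y′   ≡⟨ eq ⟨
        point c x +ᵥ point c′ y     ≡⟨ ⱽ.solve 2 (λ v w → v ⱽ.:+ w ⱽ.:= w ⱽ.:+ v) refl (point c x) (point c′ y) ⟩
        point c′ y +ᵥ point c x     ∎))))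
        where
        open ≡-Reasoning
        x≡x′ : x ≡ x′
        x≡x′ = -≡0⇒≡ (meet (begin
          point c (x - x′)            ≡⟨ point-sub c x x′ ⟩
          point c x -ᵥ point c x′
            ≡⟨ ⱽ.solve 3 (λ p q r → p ⱽ.:- q ⱽ.:= (p ⱽ.:+ r) ⱽ.:- r ⱽ.:- q) refl (point c x) (point c x′) (point c′ y) ⟩
          total (x , y) -ᵥ point c′ y -ᵥ point c x′
            ≡⟨ cong (λ u → u -ᵥ point c′ y -ᵥ point c x′) eq ⟩
          total (x′ , y′) -ᵥ point c′ y -ᵥ point c x′
            ≡⟨ ⱽ.solve 3 (λ p q r → (p ⱽ.:+ q) ⱽ.:- r ⱽ.:- p ⱽ.:= q ⱽ.:- r) refl (point c x′) (point c′ y′) (point c′ y) ⟩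
          point c′ y′ -ᵥ point c′ y   ≡⟨ point-sub c′ y′ y ⟨
          point c′ (y′ - y)           ∎))

      decompose : ∀ u → ∃[ w ] ∃[ w′ ] w ∈ Points c × w′ ∈ Points c′ × u ≡ w +ᵥ w′
      decompose u =
        let (x , y) , eq = injective⇒surjective (↔-sym *↔× ↔-∘ (cardinality ×-↔ cardinality)) total-injective u
        in point c x , point c′ y , (x , refl) , (y , refl) , sym eq

  component∋ : ∀ v → ∃[ c ] v ∈ Points c
  component∋ (x , y) with x ≟ 0#
  ... | yes x≡0 = vertical , y , cong (_, y) x≡0
  ... | no  x≢0 with divide x≢0 y
  ...   | m , xm≡y with _∈L? f m
  ...     | no m∉ = slope m m∉ , x , cong₂ _,_ (sym (*-identityʳ x)) (sym xm≡y)
  ...     | yes m∈ =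
    -- With m = y / x = f(z) / z, the factor h = x / z carries (z, f(z)) to (x, y).
    let z , z≢0 , fz≡ = ∈L⇒ f m∈
        h , zh≡x = divide z≢0 x
        h≢0 : h ≢ 0#
        h≢0 h≡0 = x≢0 (trans (sym zh≡x) (trans (cong (z *_) h≡0) (zeroʳ z)))
        hz≡x = trans (*-comm h z) zh≡x
    in multiple h h≢0 , z , cong₂ _,_ (sym hz≡x) (sym (begin
         h * ⟦ f ⟧ z   ≡⟨ cong (h *_) fz≡ ⟩
         h * (m * z)   ≡⟨ solve 3 (λ h m z → h :* (m :* z) := h :* z :* m) refl h m z ⟩
         h * z * m     ≡⟨ cong (_* m) hz≡x ⟩
         x * m         ≡⟨ xm≡y ⟩
         y             ∎))
    where open ≡-Reasoning

  private
    Points-proper : ∀ c → ∃[ v ] v ∉ Points c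
    Points-proper (slope m _) = (0# , 1#) , λ (x , eq) → 1≢0 (trans (cong proj₂ eq) (trans
      (cong (_* m) (sym (trans (cong proj₁ eq) (*-identityʳ x)))) (zeroˡ m)))
    Points-proper (multiple h h≢0) = (0# , 1#) , λ (x , eq) → 1≢0 (trans (cong proj₂ eq) (trans
      (cong (λ u → h * ⟦ f ⟧ u) (*-zero-cancelˡ h≢0 (sym (cong proj₁ eq))))
      (trans (cong (h *_) (⟦⟧-0 f)) (zeroʳ h))))
    Points-proper vertical = (1# , 0#) , λ (x , eq) → 1≢0 (cong proj₁ eq)

  -- The line of `v` meets `U f` only in 0. This wording treats the vertical line and the slopes
  -- outside `L f` alike, and it can be transported along a semilinear map, which need not respect
  -- the distinction.
  Avoids : V → Set b
  Avoids v = ∀ {x} → (x , ⟦ f ⟧ x) ∈ span v → x ≡ 0#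

  IsLine : Subset → Set b
  IsLine W = ∃[ v ] v ≢ 0ᵥ × Avoids v × W ≐ span v

  IsMultiple : Subset → Set b
  IsMultiple W = ∃[ h ] h ≢ 0# × W ≐ scale h (U f)

  line-or-multiple : ∀ {W} → W ∈ 𝓑 f → IsLine W ⊎ IsMultiple W
  line-or-multiple (inj₁ (m , m∉ , W≐)) = inj₁ ((1# , m) , (λ eq → 1≢0 (cong proj₁ eq)) , avoids , W≐)
    where
    avoids : Avoids (1# , m)
    avoids {x} (k , eq) = decidable-stable (x ≟ 0#) λ x≢0 → m∉ (∈L⇐ f x≢0 (begin
      ⟦ f ⟧ x   ≡⟨ cong proj₂ eq ⟩
      k * m     ≡⟨ cong (_* m) (trans (cong proj₁ eq) (*-identityʳ k)) ⟨
      x * m     ≡⟨ *-comm x m ⟩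
      m * x     ∎))
      where open ≡-Reasoning
  line-or-multiple (inj₂ (inj₁ W-multiple)) = inj₂ W-multiple
  line-or-multiple (inj₂ (inj₂ W≐)) = inj₁ ((0# , 1#) , (λ eq → 1≢0 (cong proj₂ eq))
    , (λ (k , eq) → trans (cong proj₁ eq) (zeroʳ k))
    , ≐-trans W≐
        ( (λ {v} x≡0 → proj₂ v , cong₂ _,_ (trans x≡0 (sym (zeroʳ _))) (sym (*-identityʳ _)))
        , (λ (k , eq) → trans (cong proj₁ eq) (zeroʳ k))))

  private
    span-multiple : ∀ {k v} → k ≢ 0# → span (k ·ᵥ v) ≐ span v
    span-multiple {k} k≢0 =
        (λ (c , w≡) → c * k , trans w≡ (cong₂ _,_ (sym (*-assoc _ _ _)) (sym (*-assoc _ _ _))))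
      , (λ (c , w≡) → let d , kd≡c = divide k≢0 c in
          d , trans w≡ (cong₂ _,_ (regroup kd≡c _) (regroup kd≡c _)))
      where
      regroup : ∀ {c d} → k * d ≡ c → ∀ x → c * x ≡ d * (k * x)
      regroup {d = d} refl x = solve 3 (λ k d x → k :* d :* x := d :* (k :* x)) refl k d x

  -- Consider the component through v. If it were a multiple `scale h (U f)`, then v / h would be a
  -- nonzero vector of `U f` on the line of v.
  avoiding-line : ∀ {v} → v ≢ 0ᵥ → Avoids v → ∃[ W ] W ∈ 𝓑 f × span v ≐ W
  avoiding-line {v} v≢0 avoids with component∋ v
  ... | slope m m∉ , x , refl = span (1# , m) , inj₁ (m , m∉ , ≐-refl) ,
    span-multiple (λ x≡0 → v≢0 (trans (cong (point (slope m m∉)) x≡0) (point-0 (slope m m∉))))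
  ... | vertical , y , refl = verticalAxis , inj₂ (inj₂ ≐-refl)
    , (λ (c , eq) → trans (cong proj₁ eq) (zeroʳ c))
    , (λ {w} w₁≡0 → let c , yc≡ = divide (λ y≡0 → v≢0 (cong (0# ,_) y≡0)) (proj₂ w) in
        c , cong₂ _,_ (trans w₁≡0 (sym (zeroʳ c))) (trans (sym yc≡) (*-comm y c)))
  ... | multiple h h≢0 , x , refl = contradiction
    (trans (cong (scaledU f h) (avoids (k , cong₂ _,_ (undo x) (undo (⟦ f ⟧ x))))) (point-0 (multiple h h≢0))) v≢0
    where
    k = proj₁ (divide h≢0 1#)
    undo : ∀ x → x ≡ k * (h * x)
    undo x = trans (sym (*-identityˡ x)) (trans (cong (_* x) (sym (proj₂ (divide h≢0 1#))))
      (solve 3 (λ h k x → h :* k :* x := k :* (h :* x)) refl h k x))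

  isPlanarSpread : IsPlanarSpread (𝓑 f)
  isPlanarSpread = record
    { 0-closed = λ W∈ → let c , _ , sup = component W∈ in sup (0# , sym (point-0 c))
    ; subtract-closed = λ W∈ v∈ w∈ →
        let c , sub , sup = component W∈
            x , v≡ = sub v∈
            y , w≡ = sub w∈
        in sup (x - y , trans (cong₂ _-ᵥ_ v≡ w≡) (sym (point-sub c x y)))
    ; cover = λ v →
        let c , v∈ = component∋ v
            W , W∈ , _ , sup = Points∈𝓑 c
        in W , W∈ , sup v∈
    ; dichotomy = λ W∈ W′∈ →
        let c  , W≐  = component W∈
            c′ , W′≐ = component W′∈
        in [ (λ eq → inj₁ (≐-trans W≐ (≐-trans eq (≐-sym W′≐))))
           , (λ (decompose , trivial) → inj₂
               ( (λ u → let w , w′ , w∈ , w′∈ , u≡ = decompose u in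
                    w , w′ , proj₂ W≐ w∈ , proj₂ W′≐ w′∈ , u≡)
               , (λ {u} u∈ u∈′ → trivial (proj₁ W≐ u∈) (proj₁ W′≐ u∈′))))
           ]′ (dichotomy c c′)
    ; proper = λ W∈ →
        let c , sub , _ = component W∈
            v , v∉ = Points-proper c
        in v , λ v∈ → v∉ (sub v∈)
    ; nontrivial = λ W∈ → let c , _ , sup = component W∈ in point c 1# , sup (1# , refl) , point≢0 c 1≢0
    }

-- Semilinearity of additive maps that preserve many lines

module Semilinearity
  {a b q n} (F : FiniteField a q) (K : FiniteField b n)
  (ι : FiniteField.Carrier F → FiniteField.Carrier K)
  where
  open FiniteField K using (Carrier; _+_; _*_; -_; _-_; 0#; 1#; cardinality)
  open Field K
  open ScatteredPolynomials F K ι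
  open PlanarSpreads F K ι
  open ≡-Reasoning

  Parallel : V → V → Set b
  Parallel v w = proj₁ v * proj₂ w ≡ proj₁ w * proj₂ v

  determinant : V → V → Carrier
  determinant v w = proj₁ v * proj₂ w - proj₁ w * proj₂ v

  parallel⇒multiple : ∀ {v w} → w ≢ 0ᵥ → Parallel v w → ∃[ k ] v ≡ k ·ᵥ w
  parallel⇒multiple {v₁ , v₂} {w₁ , w₂} w≢0 eq with w₁ ≟ 0#
  ... | no w₁≢0 =
    let k , w₁k≡v₁ = divide w₁≢0 v₁ in
    k , cong₂ _,_ (trans (sym w₁k≡v₁) (*-comm w₁ k)) (*-cancelˡ w₁≢0 (begin
      w₁ * v₂         ≡⟨ eq ⟨
      v₁ * w₂         ≡⟨ cong (_* w₂) w₁k≡v₁ ⟨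
      w₁ * k * w₂     ≡⟨ *-assoc w₁ k w₂ ⟩
      w₁ * (k * w₂)   ∎))
  ... | yes refl =
    let w₂≢0 : w₂ ≢ 0#
        w₂≢0 = λ w₂≡0 → w≢0 (cong (0# ,_) w₂≡0)
        k , w₂k≡v₂ = divide w₂≢0 v₂
        v₁≡0 : v₁ ≡ 0#
        v₁≡0 = *-zero-cancelˡ w₂≢0 (trans (*-comm w₂ v₁) (trans eq (zeroˡ v₂)))
    in k , cong₂ _,_ (trans v₁≡0 (sym (zeroʳ k))) (trans (sym w₂k≡v₂) (*-comm w₂ k))

  multiple⇒parallel : ∀ k w → Parallel (k ·ᵥ w) w
  multiple⇒parallel k (w₁ , w₂) = solve 3 (λ k x y → k :* x :* y := x :* (k :* y)) refl k w₁ w₂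

  ·ᵥ-cancelʳ : ∀ {k l w} → w ≢ 0ᵥ → k ·ᵥ w ≡ l ·ᵥ w → k ≡ l
  ·ᵥ-cancelʳ {k} {l} {w₁ , w₂} w≢0 eq with w₁ ≟ 0#
  ... | no  w₁≢0 = *-cancelˡ w₁≢0 (trans (*-comm w₁ k) (trans (cong proj₁ eq) (*-comm l w₁)))
  ... | yes refl = *-cancelˡ (λ w₂≡0 → w≢0 (cong (0# ,_) w₂≡0))
    (trans (*-comm w₂ k) (trans (cong proj₂ eq) (*-comm l w₂)))

  ·ᵥ-assoc : ∀ k l v → k ·ᵥ (l ·ᵥ v) ≡ (k * l) ·ᵥ v
  ·ᵥ-assoc k l (x , y) = cong₂ _,_ (sym (*-assoc k l x)) (sym (*-assoc k l y))

  ·ᵥ-identity : ∀ v → 1# ·ᵥ v ≡ v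
  ·ᵥ-identity (x , y) = cong₂ _,_ (*-identityˡ x) (*-identityˡ y)

  ·ᵥ-distribˡ : ∀ k v w → k ·ᵥ (v +ᵥ w) ≡ k ·ᵥ v +ᵥ k ·ᵥ w
  ·ᵥ-distribˡ k (x , y) (x′ , y′) = cong₂ _,_ (distribˡ k x x′) (distribˡ k y y′)

  ·ᵥ-distribʳ : ∀ k l v → (k + l) ·ᵥ v ≡ k ·ᵥ v +ᵥ l ·ᵥ v
  ·ᵥ-distribʳ k l (x , y) = cong₂ _,_ (distribʳ x k l) (distribʳ y k l)

  combination : Carrier → V → Carrier → V → V
  combination k v l w = k ·ᵥ v +ᵥ l ·ᵥ w

  ·ᵥ-combination : ∀ c k v l w → c ·ᵥ combination k v l w ≡ combination (c * k) v (c * l) w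
  ·ᵥ-combination c k v l w = trans (·ᵥ-distribˡ c (k ·ᵥ v) (l ·ᵥ w))
    (cong₂ _+ᵥ_ (·ᵥ-assoc c k v) (·ᵥ-assoc c l w))

  module Basis {v w : V} (independent : ¬ Parallel v w) where
    private
      v₁ = proj₁ v
      v₂ = proj₂ v
      w₁ = proj₁ w
      w₂ = proj₂ w
      D = determinant v w

      D≢0 : D ≢ 0#
      D≢0 D≡0 = independent (-≡0⇒≡ D≡0)

    coordinates-unique : ∀ {k l k′ l′} → combination k v l w ≡ combination k′ v l′ w → k ≡ k′ × l ≡ l′
    coordinates-unique {k} {l} {k′} {l′} eq =
        *-cancelˡ D≢0 (begin
          D * k                                            ≡⟨ first k l ⟩
          (k * v₁ + l * w₁) * w₂ - w₁ * (k * v₂ + l * w₂)  ≡⟨ cong₂ (λ x y → x * w₂ - w₁ * y) (cong proj₁ eq) (cong proj₂ eq) ⟩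
          (k′ * v₁ + l′ * w₁) * w₂ - w₁ * (k′ * v₂ + l′ * w₂) ≡⟨ first k′ l′ ⟨
          D * k′                                           ∎)
      , *-cancelˡ D≢0 (begin
          D * l                                            ≡⟨ second k l ⟩
          v₁ * (k * v₂ + l * w₂) - (k * v₁ + l * w₁) * v₂  ≡⟨ cong₂ (λ x y → v₁ * y - x * v₂) (cong proj₁ eq) (cong proj₂ eq) ⟩
          v₁ * (k′ * v₂ + l′ * w₂) - (k′ * v₁ + l′ * w₁) * v₂ ≡⟨ second k′ l′ ⟨
          D * l′                                           ∎)
      where
      first : ∀ k l → D * k ≡ (k * v₁ + l * w₁) * w₂ - w₁ * (k * v₂ + l * w₂)
      first k l = solve 6 (λ k l a b c d → (a :* d :- c :* b) :* k :=
        (k :* a :+ l :* c) :* d :- c :* (k :* b :+ l :* d)) refl k l v₁ v₂ w₁ w₂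
      second : ∀ k l → D * l ≡ v₁ * (k * v₂ + l * w₂) - (k * v₁ + l * w₁) * v₂
      second k l = solve 6 (λ k l a b c d → (a :* d :- c :* b) :* l :=
        a :* (k :* b :+ l :* d) :- (k :* a :+ l :* c) :* b) refl k l v₁ v₂ w₁ w₂

    -- Cramer's rule.
    coordinates : ∀ u → ∃[ k ] ∃[ l ] u ≡ combination k v l w
    coordinates u@(u₁ , u₂) =
      let k , Dk≡ = divide D≢0 (determinant u w)
          l , Dl≡ = divide D≢0 (determinant v u)
          expand : ∀ x y z → D * z ≡ determinant u w * x + determinant v u * y → z ≡ k * x + l * y
          expand x y z eq = *-cancelˡ D≢0 (begin
            D * z                                         ≡⟨ eq ⟩
            determinant u w * x + determinant v u * y     ≡⟨ cong₂ (λ p q → p * x + q * y) Dk≡ Dl≡ ⟨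
            D * k * x + D * l * y                         ≡⟨ solve 5 (λ d k l x y → d :* k :* x :+ d :* l :* y := d :* (k :* x :+ l :* y)) refl D k l x y ⟩
            D * (k * x + l * y)                           ∎)
      in k , l , cong₂ _,_
        (expand v₁ w₁ u₁ (solve 6 (λ x y a b c d → (a :* d :- c :* b) :* x :=
          (x :* d :- c :* y) :* a :+ (a :* y :- x :* b) :* c) refl u₁ u₂ v₁ v₂ w₁ w₂))
        (expand v₂ w₂ u₂ (solve 6 (λ x y a b c d → (a :* d :- c :* b) :* y :=
          (x :* d :- c :* y) :* b :+ (a :* y :- x :* b) :* d) refl u₁ u₂ v₁ v₂ w₁ w₂))

  module _ {φ : V → V} (φ-+ : Additive φ) (φ-injective : Injective _≡_ _≡_ φ) where

    MapsLineToLine : V → Set b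
    MapsLineToLine v = ∀ x → ∃[ k ] φ (x ·ᵥ v) ≡ k ·ᵥ φ v

    private
      φ≢0 : ∀ {v} → v ≢ 0ᵥ → φ v ≢ 0ᵥ
      φ≢0 v≢0 eq = v≢0 (φ-injective (trans eq (sym (additive⇒0 φ-+))))

      module Multiplier {v} (v≢0 : v ≢ 0ᵥ) (line : MapsLineToLine v) where
        g : Carrier → Carrier
        g x = proj₁ (line x)

        g-spec : ∀ x → φ (x ·ᵥ v) ≡ g x ·ᵥ φ v
        g-spec x = proj₂ (line x)

        g-+ : ∀ x y → g (x + y) ≡ g x + g y
        g-+ x y = ·ᵥ-cancelʳ (φ≢0 v≢0) (begin
          g (x + y) ·ᵥ φ v            ≡⟨ g-spec (x + y) ⟨
          φ ((x + y) ·ᵥ v)            ≡⟨ cong φ (·ᵥ-distribʳ x y v) ⟩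
          φ (x ·ᵥ v +ᵥ y ·ᵥ v)        ≡⟨ φ-+ _ _ ⟩
          φ (x ·ᵥ v) +ᵥ φ (y ·ᵥ v)    ≡⟨ cong₂ _+ᵥ_ (g-spec x) (g-spec y) ⟩
          g x ·ᵥ φ v +ᵥ g y ·ᵥ φ v    ≡⟨ ·ᵥ-distribʳ (g x) (g y) (φ v) ⟨
          (g x + g y) ·ᵥ φ v          ∎)

        g-1 : g 1# ≡ 1#
        g-1 = ·ᵥ-cancelʳ (φ≢0 v≢0) (trans (sym (g-spec 1#))
          (trans (cong φ (·ᵥ-identity v)) (sym (·ᵥ-identity (φ v)))))

        g-injective : Injective _≡_ _≡_ g
        g-injective {x} {y} eq = ·ᵥ-cancelʳ v≢0 (φ-injective
          (trans (g-spec x) (trans (cong (_·ᵥ φ v) eq) (sym (g-spec y)))))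

    module Frame {v w : V} (independent : ¬ Parallel v w)
      (v-line : MapsLineToLine v) (w-line : MapsLineToLine w) (v+w-line : MapsLineToLine (v +ᵥ w))
      where
      private
        v≢0 : v ≢ 0ᵥ
        v≢0 refl = independent (trans (zeroˡ _) (sym (zeroʳ _)))
        w≢0 : w ≢ 0ᵥ
        w≢0 refl = independent (trans (zeroʳ _) (sym (zeroˡ _)))

      open Multiplier v≢0 v-line public
      private
        module W = Multiplier w≢0 w-line

        -- The multiplier g is surjective by finiteness, so the line of v is mapped onto that of
        -- φ(v). If φ(w) lay there, injectivity would put w on the line of v.
        image-independent : ¬ Parallel (φ v) (φ w)
        image-independent parallel =
          let k , φw≡ = parallel⇒multiple (φ≢0 v≢0) (sym parallel)
              x , gx≡k = injective⇒surjective cardinality g-injective k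
              w≡ : w ≡ x ·ᵥ v
              w≡ = φ-injective (trans φw≡ (trans (cong (_·ᵥ φ v) (sym gx≡k)) (sym (g-spec x))))
          in independent (sym (subst (λ u → Parallel u v) (sym w≡) (multiple⇒parallel x v)))

        module φBasis = Basis image-independent

        φ-combination′ : ∀ x y → φ (combination x v y w) ≡ combination (g x) (φ v) (W.g y) (φ w)
        φ-combination′ x y = trans (φ-+ _ _) (cong₂ _+ᵥ_ (g-spec x) (W.g-spec y))

        -- On the diagonal `v +ᵥ w` the map multiplies by a single factor k; comparing coordinates
        -- shows that both multipliers equal it.
        g≡W-g : ∀ x → g x ≡ W.g x
        g≡W-g x =
          let k , eq = v+w-line x
              gx≡k , Wgx≡k = φBasis.coordinates-unique (begin
                combination (g x) (φ v) (W.g x) (φ w)   ≡⟨ φ-combination′ x x ⟨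
                φ (combination x v x w)                 ≡⟨ cong φ (·ᵥ-distribˡ x v w) ⟨
                φ (x ·ᵥ (v +ᵥ w))                       ≡⟨ eq ⟩
                k ·ᵥ φ (v +ᵥ w)                         ≡⟨ cong (k ·ᵥ_) (φ-+ v w) ⟩
                k ·ᵥ (φ v +ᵥ φ w)                       ≡⟨ ·ᵥ-distribˡ k (φ v) (φ w) ⟩
                combination k (φ v) k (φ w)             ∎)
          in trans gx≡k (sym Wgx≡k)

      φ-combination : ∀ x y → φ (combination x v y w) ≡ combination (g x) (φ v) (g y) (φ w)
      φ-combination x y = trans (φ-combination′ x y)
        (cong (λ u → combination (g x) (φ v) u (φ w)) (sym (g≡W-g y)))

      g-0 : g 0# ≡ 0#
      g-0 = trans (solve 1 (λ u → u := (u :+ u) :- u) refl (g 0#))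
        (trans (cong (_- g 0#) (trans (sym (g-+ 0# 0#)) (cong g (+-identityˡ 0#)))) (-‿inverseʳ _))

      g≢0 : ∀ {x} → x ≢ 0# → g x ≢ 0#
      g≢0 x≢0 eq = x≢0 (g-injective (trans eq (sym g-0)))

      g-sub : ∀ x y → g (x - y) ≡ g x - g y
      g-sub x y = begin
        g (x - y)               ≡⟨ solve 2 (λ u v → u := u :+ v :- v) refl (g (x - y)) (g y) ⟩
        g (x - y) + g y - g y   ≡⟨ cong (_- g y) (g-+ (x - y) y) ⟨
        g (x - y + y) - g y     ≡⟨ cong (λ u → g u - g y) (solve 2 (λ x y → x :- y :+ y := x) refl x y) ⟩
        g x - g y               ∎

      Multiplicative : Carrier → Set b
      Multiplicative μ = ∀ x → g (μ * x) ≡ g μ * g x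

      multiplicative-sub : ∀ {μ ν} → Multiplicative μ → Multiplicative ν → Multiplicative (μ - ν)
      multiplicative-sub {μ} {ν} μ-mult ν-mult x = begin
        g ((μ - ν) * x)           ≡⟨ cong g (solve 3 (λ m n x → (m :- n) :* x := m :* x :- n :* x) refl μ ν x) ⟩
        g (μ * x - ν * x)         ≡⟨ g-sub _ _ ⟩
        g (μ * x) - g (ν * x)     ≡⟨ cong₂ _-_ (μ-mult x) (ν-mult x) ⟩
        g μ * g x - g ν * g x     ≡⟨ solve 3 (λ m n x → m :* x :- n :* x := (m :- n) :* x) refl (g μ) (g ν) (g x) ⟩
        (g μ - g ν) * g x         ≡⟨ cong (_* g x) (g-sub μ ν) ⟨
        g (μ - ν) * g x           ∎

      -- Closure under division, ν = (μν) / μ, in the form that `square-bound` uses.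
      multiplicative-quotient : ∀ {μ ν} → μ ≢ 0# → Multiplicative μ → Multiplicative (μ * ν) → Multiplicative ν
      multiplicative-quotient {μ} {ν} μ≢0 μ-mult μν-mult x = *-cancelˡ (g≢0 μ≢0) (begin
        g μ * g (ν * x)     ≡⟨ μ-mult (ν * x) ⟨
        g (μ * (ν * x))     ≡⟨ cong g (*-assoc μ ν x) ⟨
        g (μ * ν * x)       ≡⟨ μν-mult x ⟩
        g (μ * ν) * g x     ≡⟨ cong (_* g x) (μ-mult ν) ⟩
        g μ * g ν * g x     ≡⟨ *-assoc _ _ _ ⟩
        g μ * (g ν * g x)   ∎)

      -- Scaling the vector by z = x / P must scale its image, which gives g(P) g(xμ) = g(x) g(Pμ).
      -- The case x = 1 yields g(Pμ) = g(P) g(μ), and g(P) cancels. The factor P is kept because the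
      -- vectors (1, m) are not normalised in the new coordinates.
      line⇒multiplicative : ∀ {P μ} → P ≢ 0# → MapsLineToLine (combination P v (P * μ) w) → Multiplicative μ
      line⇒multiplicative {P} {μ} P≢0 line x = *-cancelˡ (g≢0 P≢0) (begin
        g P * g (μ * x)     ≡⟨ cong (λ u → g P * g u) (*-comm μ x) ⟩
        g P * g (x * μ)     ≡⟨ proportion x ⟩
        g x * g (P * μ)     ≡⟨ cong (g x *_) gPμ ⟩
        g x * (g P * g μ)   ≡⟨ solve 3 (λ x p m → x :* (p :* m) := p :* (m :* x)) refl (g x) (g P) (g μ) ⟩
        g P * (g μ * g x)   ∎)
        where
        proportion : ∀ x → g P * g (x * μ) ≡ g x * g (P * μ)
        proportion x =
          let z , Pz≡x = divide P≢0 x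
              k , eq = line z
              gzP≡ , gzPμ≡ = φBasis.coordinates-unique (begin
                combination (g (z * P)) (φ v) (g (z * (P * μ))) (φ w)   ≡⟨ φ-combination _ _ ⟨
                φ (combination (z * P) v (z * (P * μ)) w)               ≡⟨ cong φ (·ᵥ-combination z P v (P * μ) w) ⟨
                φ (z ·ᵥ combination P v (P * μ) w)                      ≡⟨ eq ⟩
                k ·ᵥ φ (combination P v (P * μ) w)                      ≡⟨ cong (k ·ᵥ_) (φ-combination P (P * μ)) ⟩
                k ·ᵥ combination (g P) (φ v) (g (P * μ)) (φ w)          ≡⟨ ·ᵥ-combination k _ _ _ _ ⟩
                combination (k * g P) (φ v) (k * g (P * μ)) (φ w)       ∎)
          in begin
            g P * g (x * μ)           ≡⟨ cong (λ u → g P * g (u * μ)) Pz≡x ⟨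
            g P * g (P * z * μ)       ≡⟨ cong (λ u → g P * g u) (solve 3 (λ p z m → p :* z :* m := z :* (p :* m)) refl P z μ) ⟩
            g P * g (z * (P * μ))     ≡⟨ cong (g P *_) gzPμ≡ ⟩
            g P * (k * g (P * μ))     ≡⟨ solve 3 (λ p k m → p :* (k :* m) := k :* p :* m) refl (g P) k _ ⟩
            k * g P * g (P * μ)       ≡⟨ cong (_* g (P * μ)) gzP≡ ⟨
            g (z * P) * g (P * μ)     ≡⟨ cong (λ u → g u * g (P * μ)) (trans (*-comm z P) Pz≡x) ⟩
            g x * g (P * μ)           ∎
        gPμ : g (P * μ) ≡ g P * g μ
        gPμ = begin
          g (P * μ)           ≡⟨ *-identityˡ _ ⟨
          1# * g (P * μ)      ≡⟨ cong (_* g (P * μ)) g-1 ⟨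
          g 1# * g (P * μ)    ≡⟨ proportion 1# ⟨
          g P * g (1# * μ)    ≡⟨ cong (λ u → g P * g u) (*-identityˡ μ) ⟩
          g P * g μ           ∎

      semilinear : (∀ μ → Multiplicative μ) → IsSemilinear φ
      semilinear mult = φ-+ , g , automorphism , λ c u →
        let k , l , u≡ = Basis.coordinates independent u in begin
          φ (c ·ᵥ u)                                             ≡⟨ cong (λ z → φ (c ·ᵥ z)) u≡ ⟩
          φ (c ·ᵥ combination k v l w)                           ≡⟨ cong φ (·ᵥ-combination c k v l w) ⟩
          φ (combination (c * k) v (c * l) w)                    ≡⟨ φ-combination _ _ ⟩
          combination (g (c * k)) (φ v) (g (c * l)) (φ w)        ≡⟨ cong₂ (λ x y → combination x (φ v) y (φ w)) (mult c k) (mult c l) ⟩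
          combination (g c * g k) (φ v) (g c * g l) (φ w)        ≡⟨ ·ᵥ-combination _ _ _ _ _ ⟨
          g c ·ᵥ combination (g k) (φ v) (g l) (φ w)             ≡⟨ cong (g c ·ᵥ_) (φ-combination k l) ⟨
          g c ·ᵥ φ (combination k v l w)                         ≡⟨ cong (λ z → g c ·ᵥ φ z) u≡ ⟨
          g c ·ᵥ φ u                                             ∎
        where
        automorphism : IsAutomorphism g
        automorphism = record
          { isRingMonomorphism = record
            { isRingHomomorphism = record
              { isSemiringHomomorphism = record
                { isNearSemiringHomomorphism = record
                  { +-isMonoidHomomorphism = record
                    { isMagmaHomomorphism = record
                      { isRelHomomorphism = record { cong = cong g }
                      ; homo = g-+ }
                    ; ε-homo = g-0 }
                  ; *-homo = mult }
                ; 1#-homo = g-1 }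
              ; -‿homo = λ x → begin
                  g (- x)       ≡⟨ cong g (+-identityˡ (- x)) ⟨
                  g (0# - x)    ≡⟨ g-sub 0# x ⟩
                  g 0# - g x    ≡⟨ cong (_- g x) g-0 ⟩
                  0# - g x      ≡⟨ +-identityˡ _ ⟩
                  - g x         ∎ }
            ; injective = g-injective }
          ; surjective = λ y → let x , gx≡y = injective⇒surjective cardinality g-injective y in
              x , λ z≡x → trans (cong g z≡x) gx≡y }

      -- The multiplicative elements form a subfield S; for x ∉ S the map
      -- (s , s′) ↦ s + s′ x is injective on S × S, so |S|² ≤ |K|.
      square-bound : ∀ {k x} → Enumeration Multiplicative k → ¬ Multiplicative x → k ℕ.* k ℕ.≤ n
      square-bound {k} {x} multiplicatives ¬mult = injection-≤ cardinality (↔-sym *↔×) {pair} pair-injective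
        where
        open Enumeration multiplicatives renaming (element to μ; injective to μ-injective; satisfies to μ-mult)

        pair : Fin k × Fin k → Carrier
        pair (i , j) = μ i + μ j * x

        pair-injective : Injective _≡_ _≡_ pair
        pair-injective {i , j} {i′ , j′} eq = cong₂ _,_
          (μ-injective (begin
            μ i                         ≡⟨ solve 2 (λ u v → u := u :+ v :- v) refl (μ i) (μ j * x) ⟩
            pair (i , j) - μ j * x      ≡⟨ cong₂ (λ y z → y - z * x) eq μj≡μj′ ⟩
            pair (i′ , j′) - μ j′ * x   ≡⟨ solve 2 (λ u v → u := u :+ v :- v) refl (μ i′) (μ j′ * x) ⟨
            μ i′                        ∎))
          (μ-injective μj≡μj′)
          where
          μj≡μj′ : μ j ≡ μ j′
          -- Otherwise x = (μ i′ - μ i) / (μ j - μ j′) would be a quotient of multiplicative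
          -- elements.
          μj≡μj′ = decidable-stable (μ j ≟ μ j′) λ μj≢μj′ → ¬mult
            (multiplicative-quotient (λ eq → μj≢μj′ (-≡0⇒≡ eq))
              (multiplicative-sub (μ-mult j) (μ-mult j′))
              (subst Multiplicative (begin
                μ i′ - μ i
                  ≡⟨ solve 3 (λ i i′ jx → i′ :- i := (i′ :+ jx) :- i :- jx) refl (μ i) (μ i′) (μ j′ * x) ⟩
                pair (i′ , j′) - μ i - μ j′ * x
                  ≡⟨ cong (λ y → y - μ i - μ j′ * x) eq ⟨
                pair (i , j) - μ i - μ j′ * x
                  ≡⟨ solve 4 (λ i j j′ x → (i :+ j :* x) :- i :- j′ :* x := (j :- j′) :* x) refl (μ i) (μ j) (μ j′) x ⟩
                (μ j - μ j′) * x                    ∎)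
                (multiplicative-sub (μ-mult i′) (μ-mult i))))

      manyMultiplicative⇒semilinear : ∀ {k} → Enumeration Multiplicative k → n ℕ.< k ℕ.* k → IsSemilinear φ
      manyMultiplicative⇒semilinear multiplicatives n<k² = semilinear λ x → decidable-stable
        (∀? cardinality λ y → g (x * y) ≟ g x * g y)
        λ ¬mult → ℕ.<⇒≱ n<k² (square-bound multiplicatives ¬mult)

-- Surviving slopes as coordinates

module ManySlopes
  {a b q n} (F : FiniteField a q) (K : FiniteField b n)
  (ι : FiniteField.Carrier F → FiniteField.Carrier K)
  where
  open FiniteField K using (Carrier; _+_; _*_; 0#; 1#; cardinality)
  open Field K
  open ScatteredPolynomials F K ι
  open PlanarSpreads F K ι
  open Semilinearity F K ι
  open ≡-Reasoning

  module _ {φ : V → V} (φ-+ : Additive φ) (φ-injective : Injective _≡_ _≡_ φ) where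

    MapsSlopeToLine : Carrier → Set b
    MapsSlopeToLine m = MapsLineToLine φ-+ φ-injective (1# , m)

    mapsSlopeToLine? : Decidable MapsSlopeToLine
    mapsSlopeToLine? m = ∀? cardinality λ x → ∃? cardinality λ k →
      ≡-dec _≟_ _≟_ (φ (x ·ᵥ (1# , m))) (k ·ᵥ φ (1# , m))

    private
      slope≢0 : ∀ {m} → (1# , m) ≢ 0ᵥ
      slope≢0 eq = 1≢0 (cong proj₁ eq)

      slopes-independent : ∀ {m m′} → m ≢ m′ → ¬ Parallel (1# , m) (1# , m′)
      slopes-independent m≢m′ eq = m≢m′ (trans (sym (*-identityˡ _)) (trans (sym eq) (*-identityˡ _)))

      -- `MapsLineToLine` refers to a chosen generator of the line; the axes of the frame below are
      -- rescaled vectors (1, m).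
      scale-line : ∀ {c v} → c ≢ 0# → v ≢ 0ᵥ → MapsLineToLine φ-+ φ-injective v →
                   MapsLineToLine φ-+ φ-injective (c ·ᵥ v)
      scale-line {c} {v} c≢0 v≢0 line x =
        let k , φxcv≡ = line (x * c)
            l , φcv≡ = line c
            l≢0 : l ≢ 0#
            l≢0 l≡0 = c≢0 (·ᵥ-cancelʳ v≢0 (φ-injective (begin
              φ (c ·ᵥ v)    ≡⟨ φcv≡ ⟩
              l ·ᵥ φ v      ≡⟨ cong (_·ᵥ φ v) l≡0 ⟩
              0# ·ᵥ φ v     ≡⟨ cong₂ _,_ (zeroˡ _) (zeroˡ _) ⟩
              0ᵥ            ≡⟨ additive⇒0 φ-+ ⟨
              φ 0ᵥ          ≡⟨ cong φ (cong₂ _,_ (zeroˡ _) (zeroˡ _)) ⟨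
              φ (0# ·ᵥ v)   ∎)))
            r , lr≡k = divide l≢0 k
        in r , (begin
          φ (x ·ᵥ (c ·ᵥ v))     ≡⟨ cong φ (·ᵥ-assoc x c v) ⟩
          φ ((x * c) ·ᵥ v)      ≡⟨ φxcv≡ ⟩
          k ·ᵥ φ v              ≡⟨ cong (_·ᵥ φ v) (trans (*-comm r l) lr≡k) ⟨
          (r * l) ·ᵥ φ v        ≡⟨ ·ᵥ-assoc r l (φ v) ⟨
          r ·ᵥ (l ·ᵥ φ v)       ≡⟨ cong (r ·ᵥ_) φcv≡ ⟨
          r ·ᵥ φ (c ·ᵥ v)       ∎)

      -- The lines of slopes number 1 and 0 become the axes. Their generators are rescaled so that
      -- the vector of slope number 2 is `w₀ +ᵥ w₁`, the diagonal. Every other vector is P (w₀ + μ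
      -- w₁) with P nonzero, except number 0: it lies on the line of `w₁`, where μ would be
      -- infinite. This is why 3 + k slopes give 2 + k values of μ.
      module Pencil {k} (slopes : Enumeration MapsSlopeToLine (3 ℕ.+ k)) where
        open Enumeration slopes renaming (element to e; injective to e-injective; satisfies to e-line)

        private
          u : Fin (3 ℕ.+ k) → V
          u i = 1# , e i

          v₀ v₁ : V
          v₀ = u (suc zero)
          v₁ = u zero

          v₀∦v₁ : ¬ Parallel v₀ v₁
          v₀∦v₁ = slopes-independent λ eq → case e-injective eq of λ ()

          module B = Basis v₀∦v₁

          A B : Fin (3 ℕ.+ k) → Carrier
          A i = proj₁ (B.coordinates (u i))
          B i = proj₁ (proj₂ (B.coordinates (u i)))

          u≡ : ∀ i → u i ≡ combination (A i) v₀ (B i) v₁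
          u≡ i = proj₂ (proj₂ (B.coordinates (u i)))

          i₂ : Fin (3 ℕ.+ k)
          i₂ = suc (suc zero)

          multiple-of-slope : ∀ {i j c} → u i ≡ c ·ᵥ u j → i ≡ j
          multiple-of-slope {i} {j} {c} eq = e-injective (begin
            e i        ≡⟨ cong proj₂ eq ⟩
            c * e j    ≡⟨ cong (_* e j) (trans (sym (*-identityʳ c)) (sym (cong proj₁ eq))) ⟩
            1# * e j   ≡⟨ *-identityˡ _ ⟩
            e j        ∎)

          A≢0 : ∀ i → A (suc i) ≢ 0#
          A≢0 i A≡0 = case multiple-of-slope {suc i} {zero} {B (suc i)} (trans (u≡ (suc i)) (begin
            combination (A (suc i)) v₀ (B (suc i)) v₁   ≡⟨ cong (λ z → combination z v₀ (B (suc i)) v₁) A≡0 ⟩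
            combination 0# v₀ (B (suc i)) v₁            ≡⟨ cong₂ _,_ (absorbˡ _ _) (absorbˡ _ _) ⟩
            B (suc i) ·ᵥ v₁                             ∎)) of λ ()
            where
            absorbˡ : ∀ x y → 0# * x + y ≡ y
            absorbˡ = solve 2 (λ x y → con (ℤ.+ 0) :* x :+ y := y) refl

          B₂≢0 : B i₂ ≢ 0#
          B₂≢0 B≡0 = case multiple-of-slope {i₂} {suc zero} {A i₂} (trans (u≡ i₂) (begin
            combination (A i₂) v₀ (B i₂) v₁   ≡⟨ cong (λ z → combination (A i₂) v₀ z v₁) B≡0 ⟩
            combination (A i₂) v₀ 0# v₁       ≡⟨ cong₂ _,_ (absorbʳ _ _) (absorbʳ _ _) ⟩
            A i₂ ·ᵥ v₀                        ∎)) of λ ()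
            where
            absorbʳ : ∀ x y → y + 0# * x ≡ y
            absorbʳ = solve 2 (λ x y → y :+ con (ℤ.+ 0) :* x := y) refl

          w₀ w₁ : V
          w₀ = A i₂ ·ᵥ v₀
          w₁ = B i₂ ·ᵥ v₁

          w₀∦w₁ : ¬ Parallel w₀ w₁
          w₀∦w₁ parallel = v₀∦v₁ (*-cancelˡ (*-nonzero (A≢0 (suc zero)) B₂≢0) (begin
            A i₂ * B i₂ * (1# * e zero)         ≡⟨ regroup (A i₂) (B i₂) 1# (e zero) ⟩
            A i₂ * 1# * (B i₂ * e zero)         ≡⟨ parallel ⟩
            B i₂ * 1# * (A i₂ * e (suc zero))   ≡⟨ regroup (B i₂) (A i₂) 1# _ ⟨
            B i₂ * A i₂ * (1# * e (suc zero))   ≡⟨ cong (_* (1# * e (suc zero))) (*-comm (B i₂) (A i₂)) ⟩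
            A i₂ * B i₂ * (1# * e (suc zero))   ∎))
            where
            regroup : ∀ x y z w → x * y * (z * w) ≡ x * z * (y * w)
            regroup = solve 4 (λ x y z w → x :* y :* (z :* w) := x :* z :* (y :* w)) refl

        open Frame φ-+ φ-injective w₀∦w₁
          (scale-line (A≢0 (suc zero)) slope≢0 (e-line (suc zero)))
          (scale-line B₂≢0 slope≢0 (e-line zero))
          (subst (MapsLineToLine φ-+ φ-injective) (u≡ i₂) (e-line i₂))

        private
          P Q : Fin (2 ℕ.+ k) → Carrier
          P i = proj₁ (divide (A≢0 (suc zero)) (A (suc i)))
          Q i = proj₁ (divide B₂≢0 (B (suc i)))

          P≢0 : ∀ i → P i ≢ 0#
          P≢0 i P≡0 = A≢0 i (trans (sym (proj₂ (divide (A≢0 (suc zero)) (A (suc i)))))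
            (trans (cong (A i₂ *_) P≡0) (zeroʳ _)))

        μ : Fin (2 ℕ.+ k) → Carrier
        μ i = proj₁ (divide (P≢0 i) (Q i))

        private
          u≡Pμ : ∀ i → u (suc i) ≡ combination (P i) w₀ (P i * μ i) w₁
          u≡Pμ i = trans (u≡ (suc i)) (cong₂ _+ᵥ_
            (trans (cong (_·ᵥ v₀) (trans (sym (proj₂ (divide (A≢0 (suc zero)) (A (suc i))))) (*-comm _ _)))
                   (sym (·ᵥ-assoc (P i) (A i₂) v₀)))
            (trans (cong (_·ᵥ v₁) (trans (sym (proj₂ (divide B₂≢0 (B (suc i)))))
                     (trans (*-comm _ _) (cong (_* B i₂) (sym (proj₂ (divide (P≢0 i) (Q i))))))))
                   (sym (·ᵥ-assoc (P i * μ i) (B i₂) v₁))))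

        μ-multiplicative : ∀ i → Multiplicative (μ i)
        μ-multiplicative i = line⇒multiplicative (P≢0 i)
          (subst (MapsLineToLine φ-+ φ-injective) (u≡Pμ i) (e-line (suc i)))

        μ-injective : Injective _≡_ _≡_ μ
        μ-injective {i} {j} μi≡μj = suc-injective (multiple-of-slope (begin
          u (suc i)                                      ≡⟨ factor i ⟩
          P i ·ᵥ (w₀ +ᵥ μ i ·ᵥ w₁)                       ≡⟨ cong (λ z → P i ·ᵥ (w₀ +ᵥ z ·ᵥ w₁)) μi≡μj ⟩
          P i ·ᵥ (w₀ +ᵥ μ j ·ᵥ w₁)                       ≡⟨ cong (_·ᵥ (w₀ +ᵥ μ j ·ᵥ w₁)) (proj₂ (divide (P≢0 j) (P i))) ⟨
          (P j * r) ·ᵥ (w₀ +ᵥ μ j ·ᵥ w₁)                 ≡⟨ cong (_·ᵥ (w₀ +ᵥ μ j ·ᵥ w₁)) (*-comm (P j) r) ⟩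
          (r * P j) ·ᵥ (w₀ +ᵥ μ j ·ᵥ w₁)                 ≡⟨ ·ᵥ-assoc r (P j) _ ⟨
          r ·ᵥ (P j ·ᵥ (w₀ +ᵥ μ j ·ᵥ w₁))                ≡⟨ cong (r ·ᵥ_) (factor j) ⟨
          r ·ᵥ u (suc j)                                 ∎))
          where
          r : Carrier
          r = proj₁ (divide (P≢0 j) (P i))
          factor : ∀ i → u (suc i) ≡ P i ·ᵥ (w₀ +ᵥ μ i ·ᵥ w₁)
          factor i = trans (u≡Pμ i) (trans (cong (P i ·ᵥ w₀ +ᵥ_) (sym (·ᵥ-assoc (P i) (μ i) w₁)))
            (sym (·ᵥ-distribˡ (P i) w₀ (μ i ·ᵥ w₁))))

        dense⇒semilinear : n ℕ.< (2 ℕ.+ k) ℕ.* (2 ℕ.+ k) → IsSemilinear φ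
        dense⇒semilinear = manyMultiplicative⇒semilinear record
          { element = μ ; injective = μ-injective ; satisfies = μ-multiplicative }

    -- Up to five slopes would allow at most 15 elements, against 16 ≤ n; these are the first
    -- clauses. From six slopes on, the square of the number of slopes other than the one at
    -- infinity exceeds 3 times the number of slopes, hence n.
    manySlopes⇒semilinear : ∀ {k} → Enumeration MapsSlopeToLine k →
      n ℕ.≤ 3 ℕ.* k → 16 ℕ.≤ n → IsSemilinear φ
    manySlopes⇒semilinear {0} slopes n≤ 16≤n = contradiction (ℕ.≤-trans 16≤n n≤) λ ()
    manySlopes⇒semilinear {1} slopes n≤ 16≤n = contradiction (ℕ.≤-trans 16≤n n≤) (ℕ.<⇒≱ (ℕ.m≤m+n 4 12))
    manySlopes⇒semilinear {2} slopes n≤ 16≤n = contradiction (ℕ.≤-trans 16≤n n≤) (ℕ.<⇒≱ (ℕ.m≤m+n 7 9))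
    manySlopes⇒semilinear {3} slopes n≤ 16≤n = contradiction (ℕ.≤-trans 16≤n n≤) (ℕ.<⇒≱ (ℕ.m≤m+n 10 6))
    manySlopes⇒semilinear {4} slopes n≤ 16≤n = contradiction (ℕ.≤-trans 16≤n n≤) (ℕ.<⇒≱ (ℕ.m≤m+n 13 3))
    manySlopes⇒semilinear {5} slopes n≤ 16≤n = contradiction (ℕ.≤-trans 16≤n n≤) (ℕ.<⇒≱ (ℕ.m≤m+n 16 0))
    manySlopes⇒semilinear {ℕ.suc (ℕ.suc (ℕ.suc (ℕ.suc (ℕ.suc (ℕ.suc k)))))} slopes n≤ 16≤n =
      Pencil.dense⇒semilinear slopes (ℕ.≤-<-trans n≤ bound)
      where
      open +-*-Solver using () renaming (solve to solveℕ; _:+_ to _⊕_; _:*_ to _⊗_; _:=_ to _⊜_; con to κ)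
      bound : 3 ℕ.* (6 ℕ.+ k) ℕ.< (5 ℕ.+ k) ℕ.* (5 ℕ.+ k)
      -- The difference (5 + k)² - 3 (6 + k) is 7 + 7k + k²; one unit of the 7 is spent on
      -- strictness.
      bound = ℕ.≤-trans (ℕ.m≤m+n (ℕ.suc (3 ℕ.* (6 ℕ.+ k))) (6 ℕ.+ (7 ℕ.* k ℕ.+ k ℕ.* k)))
        (ℕ.≤-reflexive (solveℕ 1 (λ k → κ 1 ⊕ κ 3 ⊗ (κ 6 ⊕ k) ⊕ (κ 6 ⊕ (κ 7 ⊗ k ⊕ k ⊗ k))
          ⊜ (κ 5 ⊕ k) ⊗ (κ 5 ⊕ k)) refl k))

-- Counting the lost slopes

nonzeroElements : ∀ {a q k} (F : FiniteField a q) → k ℕ.< q →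
                  Enumeration (λ x → x ≢ FiniteField.0# F) k
nonzeroElements {q = ℕ.suc q} F (ℕ.s≤s k≤q) = record
  -- `punchIn z` runs through the indices other than the index `z` of 0.
  { element   = λ i → from (punchIn z (inject≤ i k≤q))
  ; injective = λ eq → Fin.inject≤-injective k≤q k≤q _ _ (Fin.punchIn-injective z _ _
      (trans (sym (strictlyInverseˡ _)) (trans (cong to eq) (strictlyInverseˡ _))))
  ; satisfies = λ i eq → Fin.punchInᵢ≢i z (inject≤ i k≤q) (trans (sym (strictlyInverseˡ _)) (cong to eq))
  }
  where
  open FiniteField F
  open Inverse cardinality using (to; from; strictlyInverseˡ)
  z = to 0#

module SpreadMap
  {a b q t} (q-primePower : IsPrimePower q) (3<q : 3 ℕ.< q) (1<t : 1 ℕ.< t)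
  (F : FiniteField a q) (K : FiniteField b (q ℕ.^ t))
  (ι : FiniteField.Carrier F → FiniteField.Carrier K) (embedding : IsSubfieldEmbedding F K ι)
  (f f′ : ScatteredPolynomials.LinearizedPolynomial F K ι)
  (scattered  : ScatteredPolynomials.IsScattered F K ι f)
  (scattered′ : ScatteredPolynomials.IsScattered F K ι f′)
  where
  open FiniteField K using (Carrier; _+_; _*_; _-_; 0#; 1#; cardinality)
  open Field K
  open ScatteredPolynomials F K ι
  open PlanarSpreads F K ι
  open Semilinearity F K ι
  open ManySlopes F K ι
  open ScatteredSpread {t = t} q-primePower F K ι embedding
  module S  = SpreadOfPolynomial {t = t} q-primePower F K ι embedding f scattered
  module S′ = SpreadOfPolynomial {t = t} q-primePower F K ι embedding f′ scattered′
  open ≡-Reasoning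

  private
    instance
      q-nonZero : ℕ.NonZero q
      q-nonZero = ℕ.>-nonZero (ℕ.≤-trans (ℕ.s≤s ℕ.z≤n) 3<q)

  -- 4² ≤ q² ≤ q^t, where `3<q` is read as 4 ≤ q and `1<t` as 2 ≤ t.
  16≤qᵗ : 16 ℕ.≤ q ℕ.^ t
  16≤qᵗ = ℕ.≤-trans (ℕ.^-monoˡ-≤ 2 3<q) (ℕ.^-monoʳ-≤ q 1<t)

  q<qᵗ : q ℕ.< q ℕ.^ t
  q<qᵗ = subst (ℕ._< q ℕ.^ t) (ℕ.^-identityʳ q) (ℕ.^-monoʳ-< q (ℕ.≤-trans (ℕ.s≤s (ℕ.s≤s ℕ.z≤n)) 3<q) 1<t)

  module _ {φ : V → V} (φ-+ : Additive φ) (φ-injective : Injective _≡_ _≡_ φ)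
           (components : MapsComponentsToComponents (𝓑 f) (𝓑 f′) φ)
    where
    private
      MapsSlope : Carrier → Set b
      MapsSlope = MapsSlopeToLine φ-+ φ-injective

      -- The two ways in which φ can fail to map the line of slope m to a line.
      Obstruction : Carrier → Set b
      Obstruction m = (∃[ x ] x ≢ 0# × ⟦ f ⟧ x ≡ m * x)
                    ⊎ (∃[ h ] h ≢ 0# × image φ (span (1# , m)) ≐ scale h (U f′))

      into-line : ∀ {v w} → v ≢ 0ᵥ → (∀ x → φ (x ·ᵥ v) ∈ span w) → MapsLineToLine φ-+ φ-injective v
      into-line {v} {w} v≢0 φ∈ x =
        let k , φxv≡ = φ∈ x
            l , φ1v≡ = φ∈ 1#
            φv≡ : φ v ≡ l ·ᵥ w
            φv≡ = trans (cong φ (sym (·ᵥ-identity v))) φ1v≡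
            l≢0 : l ≢ 0#
            l≢0 l≡0 = v≢0 (φ-injective (begin
              φ v       ≡⟨ φv≡ ⟩
              l ·ᵥ w    ≡⟨ cong (_·ᵥ w) l≡0 ⟩
              0# ·ᵥ w   ≡⟨ cong₂ _,_ (zeroˡ _) (zeroˡ _) ⟩
              0ᵥ        ≡⟨ additive⇒0 φ-+ ⟨
              φ 0ᵥ      ∎))
            r , lr≡k = divide l≢0 k
        in r , (begin
          φ (x ·ᵥ v)       ≡⟨ φxv≡ ⟩
          k ·ᵥ w           ≡⟨ cong (_·ᵥ w) (trans (*-comm r l) lr≡k) ⟨
          (r * l) ·ᵥ w     ≡⟨ ·ᵥ-assoc r l w ⟨
          r ·ᵥ (l ·ᵥ w)    ≡⟨ cong (r ·ᵥ_) φv≡ ⟨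
          r ·ᵥ φ v         ∎)

      obstruction : ∀ {m} → ¬ MapsSlope m → Obstruction m
      obstruction {m} ¬line with _∈L? f m
      ... | yes m∈ = inj₁ (∈L⇒ f m∈)
      ... | no  m∉ =
        let W′ , W′∈ , sub , sup = components {span (1# , m)} (inj₁ (m , m∉ , ≐-refl)) in
        [ (λ (v , _ , _ , W′⊆ , _) → contradiction
            (into-line {w = v} (λ eq → 1≢0 (cong proj₁ eq)) (λ x → W′⊆ (sub (_ , (x , refl) , refl)))) ¬line)
        , (λ (h , h≢0 , W′≐) → inj₂ (h , h≢0 , ≐-trans (sub , sup) W′≐))
        ]′ (S′.line-or-multiple W′∈)

      -- The witness of an obstruction is determined only up to 𝔽_q^*, so all its multiples are
      -- charged to the slope. Abscissas x and factors h are kept in separate copies of K, since an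
      -- element may occur in both roles.
      mark : ∀ {m} → Obstruction m → 𝔽.Carrier → Carrier ⊎ Carrier
      mark (inj₁ (x , _)) c = inj₁ (x * ι c)
      mark (inj₂ (h , _)) c = inj₂ (h * ι c)

      -- A mark determines its slope. In the first copy, y = x c gives m = f(y) / y by
      -- 𝔽_q-linearity. In the second, h c determines the image `scale h (U f′)` of the line, and φ
      -- is injective.
      mark-slope : ∀ {m m′} (o : Obstruction m) (o′ : Obstruction m′) {c c′} →
                   c ≢ 𝔽.0# → c′ ≢ 𝔽.0# → mark o c ≡ mark o′ c′ → m ≡ m′
      mark-slope {m} {m′} (inj₁ (x , x≢0 , fx≡)) (inj₁ (x′ , x′≢0 , fx′≡)) {c} {c′} c≢0 c′≢0 eq =
        *-cancelˡ (*-nonzero x≢0 (ι≢0 c≢0)) (begin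
          x * ι c * m              ≡⟨ value x c m fx≡ ⟨
          ⟦ f ⟧ (ι c * x)          ≡⟨ cong ⟦ f ⟧ (trans (*-comm _ x) (trans xc≡ (*-comm x′ _))) ⟩
          ⟦ f ⟧ (ι c′ * x′)        ≡⟨ value x′ c′ m′ fx′≡ ⟩
          x′ * ι c′ * m′           ≡⟨ cong (_* m′) xc≡ ⟨
          x * ι c * m′             ∎)
        where
        xc≡ : x * ι c ≡ x′ * ι c′
        xc≡ = inj₁-injective eq
        value : ∀ x c m → ⟦ f ⟧ x ≡ m * x → ⟦ f ⟧ (ι c * x) ≡ x * ι c * m
        value x c m fx≡ = trans (⟦⟧-ι f c x) (trans (cong (ι c *_) fx≡)
          (solve 3 (λ c m x → c :* (m :* x) := x :* c :* m) refl (ι c) m x))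
      mark-slope {m} {m′} (inj₂ (h , h≢0 , image≐)) (inj₂ (h′ , h′≢0 , image≐′)) {c} {c′} c≢0 c′≢0 eq =
        let w , (k , w≡) , φ≡ = proj₂ image≐′ (proj₁ hU≐h′U (proj₁ image≐ ((1# , m) , (1# , sym (·ᵥ-identity _)) , refl)))
            1m≡ : (1# , m) ≡ k ·ᵥ (1# , m′)
            1m≡ = trans (φ-injective φ≡) w≡
        in trans (cong proj₂ 1m≡) (trans
             (cong (_* m′) (trans (sym (*-identityʳ k)) (sym (cong proj₁ 1m≡)))) (*-identityˡ m′))
        where
        hU≐h′U : scale h (U f′) ≐ scale h′ (U f′)
        hU≐h′U = ≐-trans (≐-sym (scale-ι f′ h c≢0))
          (subst (λ u → scale u (U f′) ≐ scale h′ (U f′)) (sym (inj₂-injective eq)) (scale-ι f′ h′ c′≢0))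

      mark-injective : ∀ {m} (o : Obstruction m) {c c′} → mark o c ≡ mark o c′ → c ≡ c′
      mark-injective (inj₁ (x , x≢0 , _)) eq = ι-injective (*-cancelˡ x≢0 (inj₁-injective eq))
      mark-injective (inj₂ (h , h≢0 , _)) eq = ι-injective (*-cancelˡ h≢0 (inj₂-injective eq))

      obstruction-bound : ∀ {l} → Enumeration (∁ MapsSlope) l → l ℕ.* 3 ℕ.≤ q ℕ.^ t ℕ.+ q ℕ.^ t
      obstruction-bound {l} obstructed = injection-≤ (↔-sym +↔⊎ ↔-∘ (cardinality ⊎-↔ cardinality)) (↔-sym *↔×)
        {marks} λ {(i , j)} {(i′ , j′)} eq →
          marks-injective eq (slopes.injective (mark-slope (o i) (o i′) (units.satisfies j) (units.satisfies j′) eq))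
        where
        module slopes = Enumeration obstructed
        module units = Enumeration (nonzeroElements F 3<q)

        o : ∀ i → Obstruction (slopes.element i)
        o i = obstruction (slopes.satisfies i)

        marks : Fin l × Fin 3 → Carrier ⊎ Carrier
        marks (i , j) = mark (o i) (units.element j)

        marks-injective : ∀ {i j i′ j′} → marks (i , j) ≡ marks (i′ , j′) → i ≡ i′ → (i , j) ≡ (i′ , j′)
        marks-injective {i} eq refl = cong (i ,_) (units.injective (mark-injective (o i) eq))

    isSemilinear : IsSemilinear φ
    isSemilinear =
      let k , l , k+l≡n , slopes , obstructed = partition cardinality (mapsSlopeToLine? φ-+ φ-injective)
          n = q ℕ.^ t
      in manySlopes⇒semilinear φ-+ φ-injective slopes
           -- With l lost slopes, 3n = 3k + 3l ≤ 3k + 2n, and 2n cancels.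
           (ℕ.+-cancelʳ-≤ (n ℕ.+ n) n (3 ℕ.* k) (ℕ.≤-trans
             (ℕ.≤-reflexive (triple k l k+l≡n))
             (ℕ.+-monoʳ-≤ (3 ℕ.* k) (obstruction-bound obstructed))))
           16≤qᵗ
      where
      open +-*-Solver using () renaming (solve to solveℕ; _:+_ to _⊕_; _:*_ to _⊗_; _:=_ to _⊜_; con to κ)
      triple : ∀ k l {n} → k ℕ.+ l ≡ n → n ℕ.+ (n ℕ.+ n) ≡ 3 ℕ.* k ℕ.+ l ℕ.* 3
      triple k l refl = solveℕ 2 (λ k l → (k ⊕ l) ⊕ ((k ⊕ l) ⊕ (k ⊕ l)) ⊜ κ 3 ⊗ k ⊕ l ⊗ κ 3) refl k l

    -- If φ(U_f) were an 𝔽_{q^t}-line, so would be U_f, and then f being scattered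
    -- would force 𝔽_q = 𝔽_{q^t}.
    image-U : ∃[ h′ ] h′ ≢ 0# × image φ (U f) ≐ scale h′ (U f′)
    image-U =
      let W′ , W′∈ , φU≐W′ = components {U f} (inj₂ (inj₁ (1# , 1≢0 , U≐))) in
      [ (λ (v , _ , _ , W′≐) → contradiction (≐-trans φU≐W′ W′≐) not-line)
      , (λ (h′ , h′≢0 , W′≐) → h′ , h′≢0 , ≐-trans φU≐W′ W′≐)
      ]′ (S′.line-or-multiple W′∈)
      where
      σ : Carrier → Carrier
      σ = proj₁ (proj₂ isSemilinear)
      φ-· : ∀ c v → φ (c ·ᵥ v) ≡ σ c ·ᵥ φ v
      φ-· = proj₂ (proj₂ (proj₂ isSemilinear))

      U≐ : U f ≐ scale 1# (U f)
      U≐ = (λ {v} v∈ → v , v∈ , sym (·ᵥ-identity v))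
         , (λ (w , w∈ , v≡) → subst (_∈ U f) (sym (trans v≡ (·ᵥ-identity w))) w∈)

      not-line : ∀ {v} → ¬ (image φ (U f) ≐ span v)
      not-line {v} (φU⊆ , ⊆φU) = ℕ.<⇒≱ q<qᵗ (injection-≤ F.cardinality cardinality {section} section-injective)
        where
        module F = FiniteField F
        u₁ : V
        u₁ = 1# , ⟦ f ⟧ 1#

        -- The line φ(U_f) contains φ(u₁), hence also φ(x u₁) by semilinearity. So x u₁ lies in
        -- `U f`, and its first coordinate is x.
        linear : ∀ x → ⟦ f ⟧ x ≡ x * ⟦ f ⟧ 1#
        linear x =
          let k , φu₁≡ = φU⊆ (u₁ , (1# , refl) , refl)
              w , (z , w≡) , eq = ⊆φU {φ (x ·ᵥ u₁)} (σ x * k ,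
                trans (φ-· x u₁) (trans (cong (σ x ·ᵥ_) φu₁≡) (·ᵥ-assoc (σ x) k v)))
              xu₁≡ : x ·ᵥ u₁ ≡ (z , ⟦ f ⟧ z)
              xu₁≡ = trans (φ-injective eq) w≡
              z≡x : z ≡ x
              z≡x = trans (sym (cong proj₁ xu₁≡)) (*-identityʳ x)
          in trans (cong ⟦ f ⟧ (sym z≡x)) (sym (cong proj₂ xu₁≡))

        ι-surjective : ∀ x → ∃[ c ] x ≡ ι c
        ι-surjective x with x ≟ 0#
        ... | yes x≡0 = F.0# , trans x≡0 (sym ι-0)
        ... | no  x≢0 =
          let c , _ , x≡ = scattered-ratio f scattered 1≢0 x≢0 (trans (*-identityˡ _) (linear x))
          in c , trans x≡ (*-identityˡ _)

        section : Carrier → F.Carrier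
        section x = proj₁ (ι-surjective x)

        section-injective : Injective _≡_ _≡_ section
        section-injective {x} {y} eq =
          trans (proj₂ (ι-surjective x)) (trans (cong ι eq) (sym (proj₂ (ι-surjective y))))

  -- A line that meets `U f` only in 0 goes to a line that meets φ(U_f) = h′U_{f′}, and therefore
  -- U_{f′}, only in 0. A multiple hU_f goes to σ(h) h′ U_{f′}, where σ is the automorphism of φ.
  ΓL⇒components : ∀ {φ h′} → IsΓL φ → h′ ≢ 0# → image φ (U f) ≐ scale h′ (U f′) →
                  MapsComponentsToComponents (𝓑 f) (𝓑 f′) φ
  ΓL⇒components {φ} {h′} ((φ-injective , _) , φ-+ , σ , σ-automorphism , φ-·) h′≢0 (φU⊆ , ⊆φU) {W} W∈ =
    [ from-line , from-multiple ]′ (S.line-or-multiple W∈)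
    where
    module σ = RingMorphisms.IsRingIsomorphism σ-automorphism

    image-cong : ∀ {W′ : Subset} → W ≐ W′ → image φ W ≐ image φ W′
    image-cong (sub , sup) = (λ (x , x∈ , y≡) → x , sub x∈ , y≡) , (λ (x , x∈ , y≡) → x , sup x∈ , y≡)

    image-span : ∀ v → image φ (span v) ≐ span (φ v)
    image-span v =
        (λ (_ , (c , x≡) , y≡) → σ c , trans y≡ (trans (cong φ x≡) (φ-· c v)))
      , (λ (c , y≡) → let d , σd≡ = σ.surjective c in
          d ·ᵥ v , (d , refl) , trans y≡ (trans (cong (_·ᵥ φ v) (sym (σd≡ refl))) (sym (φ-· d v))))

    from-line : S.IsLine W → ∃[ W′ ] W′ ∈ 𝓑 f′ × image φ W ≐ W′
    from-line (v , v≢0 , avoids , W≐) =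
      let W′ , W′∈ , span≐ = S′.avoiding-line φv≢0 φv-avoids
      in W′ , W′∈ , ≐-trans (image-cong W≐) (≐-trans (image-span v) span≐)
      where
      φv≢0 : φ v ≢ 0ᵥ
      φv≢0 eq = v≢0 (φ-injective (trans eq (sym (additive⇒0 φ-+))))

      φv-avoids : S′.Avoids (φ v)
      φv-avoids {y} (c , y≡) =
        let w , (x , w≡) , h′y≡ = ⊆φU (_ , (y , refl) , refl)
            w₁ , w₁∈ , h′cφv≡ = proj₂ (image-span v) (h′ * c , trans (cong (h′ ·ᵥ_) y≡) (·ᵥ-assoc h′ c (φ v)))
            x≡0 : x ≡ 0#
            x≡0 = avoids (subst (_∈ span v) (trans (φ-injective (trans (sym h′cφv≡) h′y≡)) w≡) w₁∈)
        in *-zero-cancelˡ h′≢0 (cong proj₁ (begin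
             h′ ·ᵥ (y , ⟦ f′ ⟧ y)     ≡⟨ h′y≡ ⟩
             φ w                      ≡⟨ cong φ w≡ ⟩
             φ (x , ⟦ f ⟧ x)          ≡⟨ cong φ (cong₂ _,_ x≡0 (trans (cong ⟦ f ⟧ x≡0) (⟦⟧-0 f))) ⟩
             φ 0ᵥ                     ≡⟨ additive⇒0 φ-+ ⟩
             0ᵥ                       ∎))

    from-multiple : S.IsMultiple W → ∃[ W′ ] W′ ∈ 𝓑 f′ × image φ W ≐ W′
    from-multiple (h , h≢0 , W≐) =
      scale (σ h * h′) (U f′)
      , inj₂ (inj₁ (σ h * h′ , *-nonzero σh≢0 h′≢0 , ≐-refl))
      , ≐-trans (image-cong W≐)
          ( (λ (x , (u , u∈ , x≡) , y≡) →
              let w , w∈ , φu≡ = φU⊆ (u , u∈ , refl) in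
              w , w∈ , (trans y≡ (trans (cong φ x≡) (trans (φ-· h u)
                (trans (cong (σ h ·ᵥ_) φu≡) (·ᵥ-assoc (σ h) h′ w))))))
          , (λ (w , w∈ , y≡) →
              let u , u∈ , h′w≡ = ⊆φU (w , w∈ , refl) in
              h ·ᵥ u , (u , u∈ , refl) , trans y≡ (trans (sym (·ᵥ-assoc (σ h) h′ w))
                (trans (cong (σ h ·ᵥ_) h′w≡) (sym (φ-· h u))))))
      where
      σh≢0 : σ h ≢ 0#
      σh≢0 eq = h≢0 (σ.injective (trans eq (sym σ.0#-homo)))

-- Plane isomorphisms and orbits of ΓL

module Isomorphisms
  {a b q t} (q-primePower : IsPrimePower q) (3<q : 3 ℕ.< q) (1<t : 1 ℕ.< t)
  (F : FiniteField a q) (K : FiniteField b (q ℕ.^ t))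
  (ι : FiniteField.Carrier F → FiniteField.Carrier K) (embedding : IsSubfieldEmbedding F K ι)
  (f f′ : ScatteredPolynomials.LinearizedPolynomial F K ι)
  (scattered  : ScatteredPolynomials.IsScattered F K ι f)
  (scattered′ : ScatteredPolynomials.IsScattered F K ι f′)
  where
  open FiniteField K using (0#; 1#; _*_)
  open Field K using (divide; 1≢0; *-comm)
  open ScatteredPolynomials F K ι
  open PlanarSpreads F K ι
  open PlaneIsomorphisms F K ι
  open Semilinearity F K ι using (·ᵥ-assoc; ·ᵥ-distribˡ; ·ᵥ-identity)
  open ⱽ using (_:+_; _:-_; _:=_)
  open SpreadMap {t = t} q-primePower 3<q 1<t F K ι embedding f f′ scattered scattered′

  isomorphism⇒ΓL : (α : V ⤖ V) → IsPlaneIsomorphism (𝓐 f) (𝓐 f′) α →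
    ∃[ u ] ∃[ h′ ] ∃[ φ ] h′ ≢ 0# × IsΓL φ × image φ (U f) ≐ scale h′ (U f′) ×
      (∀ v → Bijection.to α v ≡ φ v +ᵥ u)
  isomorphism⇒ΓL α isomorphism =
    let h′ , h′≢0 , image≐ = image-U additive φ-injective components in
    to 0ᵥ , h′ , φ , h′≢0
    , ((φ-injective , φ-surjective) , isSemilinear additive φ-injective components)
    , image≐
    , λ v → ⱽ.solve 2 (λ x o → x := x :- o :+ o) refl (to v) (to 0ᵥ)
    where
    open Bijection α using (to; injective; surjective)

    φ : V → V
    φ v = to v -ᵥ to 0ᵥ

    φ-injective : Injective _≡_ _≡_ φ
    φ-injective eq = injective (+ᵥ-cancelʳ eq)

    φ-surjective : Surjective _≡_ _≡_ φ
    φ-surjective v = let w , eq = surjective (v +ᵥ to 0ᵥ) in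
      w , λ z≡w → trans (cong (_-ᵥ to 0ᵥ) (eq z≡w)) (ⱽ.solve 2 (λ v o → v :+ o :- o := v) refl v (to 0ᵥ))

    open Collineation S.isPlanarSpread S′.isPlanarSpread φ-injective
      (ⱽ.solve 1 (λ o → o :- o := :0) refl (to 0ᵥ))
      (isomorphism⇒mapsLinesToLines S.isPlanarSpread S′.isPlanarSpread α isomorphism)

  ΓL⇒isomorphism : (α : V ⤖ V) →
    ∃[ u ] ∃[ h′ ] ∃[ φ ] h′ ≢ 0# × IsΓL φ × image φ (U f) ≐ scale h′ (U f′) ×
      (∀ v → Bijection.to α v ≡ φ v +ᵥ u) →
    IsPlaneIsomorphism (𝓐 f) (𝓐 f′) α
  ΓL⇒isomorphism α (u , h′ , φ , h′≢0 , φ-ΓL , image≐ , α≡) =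
    affine⇒isomorphism S.isPlanarSpread S′.isPlanarSpread α (proj₁ (proj₂ φ-ΓL))
      (ΓL⇒components φ-ΓL h′≢0 image≐) α≡

  -- Multiplication by 1 / h′ is linear, so it can be composed with φ without changing the
  -- automorphism; the result maps `U f` onto `U f′` itself.
  isomorphic⇒sameOrbit : Isomorphic (𝓐 f) (𝓐 f′) → SameΓLOrbit (U f) (U f′)
  isomorphic⇒sameOrbit (α , isomorphism) =
    let _ , h′ , φ , h′≢0 , ((φ-injective , φ-surjective) , φ-+ , σ , σ-automorphism , φ-·) , (sub , sup) , _ =
          isomorphism⇒ΓL α isomorphism
        r , h′r≡1 = divide h′≢0 1#
        rh′ : ∀ v → r ·ᵥ (h′ ·ᵥ v) ≡ v
        rh′ v = trans (·ᵥ-assoc r h′ v) (trans (cong (_·ᵥ v) (trans (*-comm r h′) h′r≡1)) (·ᵥ-identity v))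
        h′r : ∀ v → h′ ·ᵥ (r ·ᵥ v) ≡ v
        h′r v = trans (·ᵥ-assoc h′ r v) (trans (cong (_·ᵥ v) h′r≡1) (·ᵥ-identity v))
    in (λ v → r ·ᵥ φ v)
       , ( ( (λ eq → φ-injective (trans (sym (h′r _)) (trans (cong (h′ ·ᵥ_) eq) (h′r _))))
           , (λ v → let w , eq = φ-surjective (h′ ·ᵥ v) in
                w , λ z≡w → trans (cong (r ·ᵥ_) (eq z≡w)) (rh′ v)))
         , (λ v w → trans (cong (r ·ᵥ_) (φ-+ v w)) (·ᵥ-distribˡ r (φ v) (φ w)))
         , σ , σ-automorphism
         , (λ c v → trans (cong (r ·ᵥ_) (φ-· c v)) (trans (·ᵥ-assoc r (σ c) (φ v))
             (trans (cong (_·ᵥ φ v) (*-comm r (σ c))) (sym (·ᵥ-assoc (σ c) r (φ v)))))))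
       , ( (λ (x , x∈ , y≡) → let w , w∈ , φx≡ = sub (x , x∈ , refl) in
             subst (_∈ U f′) (sym (trans y≡ (trans (cong (r ·ᵥ_) φx≡) (rh′ w)))) w∈)
         , (λ {y} y∈ → let x , x∈ , h′y≡ = sup (y , y∈ , refl) in
             x , x∈ , trans (sym (rh′ y)) (cong (r ·ᵥ_) h′y≡)))

  sameOrbit⇒isomorphic : SameΓLOrbit (U f) (U f′) → Isomorphic (𝓐 f) (𝓐 f′)
  sameOrbit⇒isomorphic (φ , φ-ΓL , (sub , sup)) = mk⤖ (proj₁ φ-ΓL) ,
    ΓL⇒isomorphism (mk⤖ (proj₁ φ-ΓL)) (0ᵥ , 1# , φ , 1≢0 , φ-ΓL
      , ( (λ {y} y∈ → y , sub y∈ , sym (·ᵥ-identity y))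
        , (λ (w , w∈ , y≡) → sup (subst (_∈ U f′) (sym (trans y≡ (·ᵥ-identity w))) w∈)))
      , λ v → ⱽ.solve 1 (λ v → v := v :+ :0) refl (φ v))

open import Data.Nat.Base using (_<_; _^_)

theorem4p2 :
    ∀ {a b} (q t : ℕ) → IsPrimePower q → 3 < q → 1 < t →
    (F : FiniteField a q) (K : FiniteField b (q ^ t)) →
    (ι : FiniteField.Carrier F → FiniteField.Carrier K) → IsSubfieldEmbedding F K ι →
    let open FiniteField K using (0#)
        open ScatteredPolynomials F K ι
    in
    (f f′ : LinearizedPolynomial) → IsScattered f → IsScattered f′ →
    ((α : V ⤖ V) →
      IsPlaneIsomorphism (𝓐 f) (𝓐 f′) α ⇔
      (∃[ u ] ∃[ h′ ] ∃[ φ ]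
        h′ ≢ 0# × IsΓL φ × image φ (U f) ≐ scale h′ (U f′) ×
        (∀ v → Bijection.to α v ≡ φ v +ᵥ u)))
    × (Isomorphic (𝓐 f) (𝓐 f′) ⇔ SameΓLOrbit (U f) (U f′))
theorem4p2 q t q-primePower 3<q 1<t F K ι embedding f f′ scattered scattered′ =
  (λ α → mk⇔ (isomorphism⇒ΓL α) (ΓL⇒isomorphism α)) , mk⇔ isomorphic⇒sameOrbit sameOrbit⇒isomorphic
  where open Isomorphisms {t = t} q-primePower 3<q 1<t F K ι embedding f f′ scattered scattered′
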